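{- For every integer $Q \ge 2$, let $F_Q = \{a/q : 1 \le a \le q \le Q,\ \gcd(a,q) = 1\}$ be the $Q$-th Farey sequence, with elements listed in increasing order as $\gamma_1 < \gamma_2 < \cdots < \gamma_{N}$, where $N = |F_Q|$. Define $$S_2(Q) = \sum_{j=1}^{N-1} (\gamma_{j+1} - \gamma_j)^2 \quad\text{and}\quad C(Q) = \frac{S_2(Q)\, Q^2}{\log Q}.$$ Then $C(Q) < 3$ for all integers $Q > 1$.
   Context: $\log$ denotes the natural logarithm. -}

module Defs where

open import Data.Integer.Base as ℤ using (+_)
import Data.Integer.Properties as ℤ
open import Data.Nat.Base as ℕ using (ℕ; zero; suc)
import Data.Nat.Properties as ℕ
open import Data.Nat.GCD using (gcd)
open import Data.List.Base using (List; []; _∷_; map; concatMap; filter; upTo)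
open import Data.Product using (∃-syntax; _×_; _,_; proj₁; proj₂)
open import Data.Rational
open import Data.Rational.Properties
open import Data.List.Sort.InsertionSort ≤-decTotalOrder using (sort)
import Data.Rational.Unnormalised as ℚᵘ
import Data.Rational.Unnormalised.Properties as ℚᵘ
open import Data.Rational.Solver using (module +-*-Solver)
open import Data.Sum using (inj₁; inj₂)
open import Relation.Binary.PropositionalEquality
open import Relation.Nullary using (yes; no; contradiction)

open +-*-Solver using (solve; _:+_; _:*_; _:-_; :-_; _:=_; con)

fromℕ : ℕ → ℚ
fromℕ n = + n / 1

-- Convention: recip 0 = 0.
recip : ℚ → ℚ
recip p with p ≟ 0ℚ
... | yes _   = 0ℚ
... | no  p≢0 = (1/ p) {{≢-nonZero p≢0}}

sumBelow : ℕ → (ℕ → ℚ) → ℚ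
sumBelow zero    f = 0ℚ
sumBelow (suc n) f = sumBelow n f + f n

fromℕ-suc : ∀ n → fromℕ (suc n) ≡ fromℕ n + 1ℚ
fromℕ-suc n = toℚᵘ-injective (begin
  toℚᵘ (fromℕ (suc n))         ≈⟨ toℚᵘ-fromℚᵘ (ℚᵘ.mkℚᵘ (+ suc n) 0) ⟩
  ℚᵘ.mkℚᵘ (+ suc n) 0          ≈⟨ ℚᵘ.*≡* eq ⟩
  ℚᵘ.mkℚᵘ (+ n) 0 ℚᵘ.+ ℚᵘ.1ℚᵘ  ≈⟨ ℚᵘ.+-congˡ ℚᵘ.1ℚᵘ (toℚᵘ-fromℚᵘ (ℚᵘ.mkℚᵘ (+ n) 0)) ⟨
  toℚᵘ (fromℕ n) ℚᵘ.+ ℚᵘ.1ℚᵘ   ≈⟨ toℚᵘ-homo-+ (fromℕ n) 1ℚ ⟨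
  toℚᵘ (fromℕ n + 1ℚ)          ∎)
  where
  open ℚᵘ.≃-Reasoning
  eq : + suc n ℤ.* + 1 ≡ (+ n ℤ.* + 1 ℤ.+ + 1) ℤ.* + 1
  eq = cong (ℤ._* + 1) (trans (cong +_ (ℕ.+-comm 1 n))
                              (cong (ℤ._+ + 1) (sym (ℤ.*-identityʳ (+ n)))))

0≤1 : 0ℚ ≤ 1ℚ
0≤1 = nonNegative⁻¹ 1ℚ

p≤p+q : ∀ p {q} → 0ℚ ≤ q → p ≤ p + q
p≤p+q p {q} 0≤q = begin
  p      ≡⟨ +-identityʳ p ⟨
  p + 0ℚ ≤⟨ +-monoʳ-≤ p 0≤q ⟩
  p + q  ∎
  where open ≤-Reasoning

*-monoʳ : ∀ {r p q} → 0ℚ ≤ r → p ≤ q → r * p ≤ r * q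
*-monoʳ {r} 0≤r = *-monoˡ-≤-nonNeg r {{nonNegative 0≤r}}

*-monoˡ : ∀ {r p q} → 0ℚ ≤ r → p ≤ q → p * r ≤ q * r
*-monoˡ {r} 0≤r = *-monoʳ-≤-nonNeg r {{nonNegative 0≤r}}

*-nonneg : ∀ {p q} → 0ℚ ≤ p → 0ℚ ≤ q → 0ℚ ≤ p * q
*-nonneg {p} {q} 0≤p 0≤q = subst (_≤ p * q) (*-zeroʳ p) (*-monoʳ 0≤p 0≤q)

*-pos : ∀ {p q} → 0ℚ < p → 0ℚ < q → 0ℚ < p * q
*-pos {p} {q} 0<p 0<q =
  positive⁻¹ (p * q) {{pos*pos⇒pos p {{positive 0<p}} q {{positive 0<q}}}}

*-mono : ∀ {p q r s} → 0ℚ ≤ r → 0ℚ ≤ q → p ≤ q → r ≤ s → p * r ≤ q * s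
*-mono 0≤r 0≤q p≤q r≤s = ≤-trans (*-monoˡ 0≤r p≤q) (*-monoʳ 0≤q r≤s)

square-nonneg : ∀ p → 0ℚ ≤ p * p
square-nonneg p with ≤-total 0ℚ p
... | inj₁ 0≤p = *-nonneg 0≤p 0≤p
... | inj₂ p≤0 = subst (0ℚ ≤_) (solve 1 (λ x → (:- x) :* (:- x) := x :* x) refl p)
                       (*-nonneg (neg-antimono-≤ p≤0) (neg-antimono-≤ p≤0))

p≤q⇒0≤q-p : ∀ {p q} → p ≤ q → 0ℚ ≤ q - p
p≤q⇒0≤q-p {p} {q} p≤q = subst (_≤ q - p) (+-inverseʳ p) (+-monoˡ-≤ (- p) p≤q)

p<q⇒0<q-p : ∀ {p q} → p < q → 0ℚ < q - p
p<q⇒0<q-p {p} {q} p<q = subst (_< q - p) (+-inverseʳ p) (+-monoˡ-< (- p) p<q)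

0≤q-p⇒p≤q : ∀ {p q} → 0ℚ ≤ q - p → p ≤ q
0≤q-p⇒p≤q {p} {q} 0≤q-p =
  subst (p ≤_) (solve 2 (λ x y → x :+ (y :- x) := y) refl p q) (p≤p+q p 0≤q-p)

∣p∣≤ : ∀ {p q} → p ≤ q → - p ≤ q → ∣ p ∣ ≤ q
∣p∣≤ {p} p≤q -p≤q with ∣p∣≡p∨∣p∣≡-p p
... | inj₁ eq = subst (_≤ _) (sym eq) p≤q
... | inj₂ eq = subst (_≤ _) (sym eq) -p≤q

p≤∣p∣ : ∀ p → p ≤ ∣ p ∣
p≤∣p∣ p with ≤-total 0ℚ p
... | inj₁ 0≤p = ≤-reflexive (sym (0≤p⇒∣p∣≡p 0≤p))
... | inj₂ p≤0 = ≤-trans p≤0 (0≤∣p∣ p)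

recip-inverse : ∀ {p} → 0ℚ < p → p * recip p ≡ 1ℚ
recip-inverse {p} 0<p with p ≟ 0ℚ
... | yes refl = contradiction 0<p (<-irrefl refl)
... | no  p≢0  = *-inverseʳ p {{≢-nonZero p≢0}}

recip-pos : ∀ {p} → 0ℚ < p → 0ℚ < recip p
recip-pos {p} 0<p with p ≟ 0ℚ
... | yes refl = contradiction 0<p (<-irrefl refl)
... | no  p≢0  = positive⁻¹ _ {{1/pos⇒pos p {{positive 0<p}}}}

recip-* : ∀ {p q} → 0ℚ < p → 0ℚ < q → recip (p * q) ≡ recip p * recip q
recip-* {p} {q} 0<p 0<q = begin
  recip (p * q)
    ≡⟨ *-identityʳ _ ⟨
  recip (p * q) * 1ℚ
    ≡⟨ cong (recip (p * q) *_) (cong₂ _*_ (recip-inverse 0<p) (recip-inverse 0<q)) ⟨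
  recip (p * q) * ((p * recip p) * (q * recip q))
    ≡⟨ solve 5 (λ a b c d e → c :* ((a :* d) :* (b :* e)) := ((a :* b) :* c) :* (d :* e))
         refl p q (recip (p * q)) (recip p) (recip q) ⟩
  ((p * q) * recip (p * q)) * (recip p * recip q)
    ≡⟨ cong (_* (recip p * recip q)) (recip-inverse (*-pos 0<p 0<q)) ⟩
  1ℚ * (recip p * recip q)
    ≡⟨ *-identityˡ _ ⟩
  recip p * recip q ∎
  where open ≡-Reasoning

recip-antitone : ∀ {p q} → 0ℚ < p → p ≤ q → recip q ≤ recip p
recip-antitone {p} {q} 0<p p≤q = begin
  recip q                     ≡⟨ *-identityˡ _ ⟨
  1ℚ * recip q                ≡⟨ cong (_* recip q) (recip-inverse 0<p) ⟨
  (p * recip p) * recip q     ≡⟨ *-assoc p _ _ ⟩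
  p * (recip p * recip q)     ≤⟨ *-monoˡ (*-nonneg (<⇒≤ (recip-pos 0<p)) (<⇒≤ (recip-pos 0<q))) p≤q ⟩
  q * (recip p * recip q)     ≡⟨ solve 3 (λ a b c → a :* (b :* c) := (a :* c) :* b) refl q _ _ ⟩
  (q * recip q) * recip p     ≡⟨ cong (_* recip p) (recip-inverse 0<q) ⟩
  1ℚ * recip p                ≡⟨ *-identityˡ _ ⟩
  recip p                     ∎
  where
  open ≤-Reasoning
  0<q = <-≤-trans 0<p p≤q

recip-difference : ∀ {p q} → 0ℚ < p → 0ℚ < q →
                   recip p - recip q ≡ (q - p) * (recip p * recip q)
recip-difference {p} {q} 0<p 0<q = begin
  recip p - recip q
    ≡⟨ cong₂ _-_ (*-identityˡ (recip p)) (*-identityˡ (recip q)) ⟨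
  1ℚ * recip p - 1ℚ * recip q
    ≡⟨ cong₂ (λ u v → u * recip p - v * recip q) (recip-inverse 0<q) (recip-inverse 0<p) ⟨
  (q * recip q) * recip p - (p * recip p) * recip q
    ≡⟨ solve 4 (λ a b c d → (b :* d) :* c :- (a :* c) :* d := (b :- a) :* (c :* d))
         refl p q (recip p) (recip q) ⟩
  (q - p) * (recip p * recip q) ∎
  where open ≡-Reasoning

fromℕ-+ : ∀ m n → fromℕ (m ℕ.+ n) ≡ fromℕ m + fromℕ n
fromℕ-+ zero    n = sym (+-identityˡ (fromℕ n))
fromℕ-+ (suc m) n = begin
  fromℕ (suc (m ℕ.+ n))       ≡⟨ fromℕ-suc (m ℕ.+ n) ⟩
  fromℕ (m ℕ.+ n) + 1ℚ        ≡⟨ cong (_+ 1ℚ) (fromℕ-+ m n) ⟩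
  (fromℕ m + fromℕ n) + 1ℚ    ≡⟨ solve 3 (λ a b c → (a :+ b) :+ c := (a :+ c) :+ b) refl (fromℕ m) (fromℕ n) 1ℚ ⟩
  (fromℕ m + 1ℚ) + fromℕ n    ≡⟨ cong (_+ fromℕ n) (fromℕ-suc m) ⟨
  fromℕ (suc m) + fromℕ n     ∎
  where open ≡-Reasoning

fromℕ-* : ∀ m n → fromℕ (m ℕ.* n) ≡ fromℕ m * fromℕ n
fromℕ-* zero    n = sym (*-zeroˡ (fromℕ n))
fromℕ-* (suc m) n = begin
  fromℕ (n ℕ.+ m ℕ.* n)           ≡⟨ fromℕ-+ n (m ℕ.* n) ⟩
  fromℕ n + fromℕ (m ℕ.* n)       ≡⟨ cong₂ _+_ (sym (*-identityˡ (fromℕ n))) (fromℕ-* m n) ⟩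
  1ℚ * fromℕ n + fromℕ m * fromℕ n ≡⟨ solve 3 (λ a b c → c :* b :+ a :* b := (a :+ c) :* b) refl (fromℕ m) (fromℕ n) 1ℚ ⟩
  (fromℕ m + 1ℚ) * fromℕ n        ≡⟨ cong (_* fromℕ n) (fromℕ-suc m) ⟨
  fromℕ (suc m) * fromℕ n         ∎
  where open ≡-Reasoning

fromℕ-nonneg : ∀ n → 0ℚ ≤ fromℕ n
fromℕ-nonneg zero    = ≤-refl
fromℕ-nonneg (suc n) = subst (0ℚ ≤_) (sym (fromℕ-suc n))
  (≤-trans (fromℕ-nonneg n) (p≤p+q (fromℕ n) 0≤1))

fromℕ-mono-≤ : ∀ {m n} → m ℕ.≤ n → fromℕ m ≤ fromℕ n
fromℕ-mono-≤ {m} {n} m≤n = subst (fromℕ m ≤_)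
  (trans (sym (fromℕ-+ m (n ℕ.∸ m))) (cong fromℕ (ℕ.m+[n∸m]≡n m≤n)))
  (p≤p+q (fromℕ m) (fromℕ-nonneg (n ℕ.∸ m)))

fromℕ-mono-< : ∀ {m n} → m ℕ.< n → fromℕ m < fromℕ n
fromℕ-mono-< {m} {n} m<n = <-≤-trans
  (subst (fromℕ m <_) (sym (fromℕ-suc m))
    (subst (_< fromℕ m + 1ℚ) (+-identityʳ _) (+-monoʳ-< (fromℕ m) (positive⁻¹ 1ℚ))))
  (fromℕ-mono-≤ m<n)

fromℕ-pos : ∀ n → 0ℚ < fromℕ (suc n)
fromℕ-pos n = fromℕ-mono-< (ℕ.s≤s (ℕ.z≤n {n}))

archimedean : ∀ p → ∃[ n ] p ≤ fromℕ n
archimedean p@(mkℚ (+ n) d-1 _) = n , toℚᵘ-cancel-≤ (begin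
  ℚᵘ.mkℚᵘ (+ n) d-1  ≤⟨ ℚᵘ.*≤* (ℤ.*-monoˡ-≤-nonNeg (+ n) (ℤ.+≤+ (ℕ.s≤s ℕ.z≤n))) ⟩
  ℚᵘ.mkℚᵘ (+ n) 0    ≃⟨ toℚᵘ-fromℚᵘ (ℚᵘ.mkℚᵘ (+ n) 0) ⟨
  toℚᵘ (fromℕ n)     ∎)
  where open ℚᵘ.≤-Reasoning
archimedean p@(mkℚ ℤ.-[1+ n ] d-1 _) = 0 , <⇒≤ (negative⁻¹ p)

sum-cong : ∀ n {f g} → (∀ i → f i ≡ g i) → sumBelow n f ≡ sumBelow n g
sum-cong zero    eq = refl
sum-cong (suc n) eq = cong₂ _+_ (sum-cong n eq) (eq n)

sum-mono : ∀ n {f g} → (∀ i → i ℕ.< n → f i ≤ g i) → sumBelow n f ≤ sumBelow n g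
sum-mono zero    le = ≤-refl
sum-mono (suc n) le =
  +-mono-≤ (sum-mono n (λ i i<n → le i (ℕ.m<n⇒m<1+n i<n))) (le n (ℕ.n<1+n n))

sum-*ˡ : ∀ n c f → sumBelow n (λ i → c * f i) ≡ c * sumBelow n f
sum-*ˡ zero    c f = sym (*-zeroʳ c)
sum-*ˡ (suc n) c f =
  trans (cong (_+ c * f n) (sum-*ˡ n c f)) (sym (*-distribˡ-+ c (sumBelow n f) (f n)))

sum-const : ∀ n c → sumBelow n (λ _ → c) ≡ fromℕ n * c
sum-const zero    c = sym (*-zeroˡ c)
sum-const (suc n) c = begin
  sumBelow n (λ _ → c) + c  ≡⟨ cong₂ _+_ (sum-const n c) (sym (*-identityˡ c)) ⟩
  fromℕ n * c + 1ℚ * c      ≡⟨ *-distribʳ-+ c (fromℕ n) 1ℚ ⟨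
  (fromℕ n + 1ℚ) * c        ≡⟨ cong (_* c) (fromℕ-suc n) ⟨
  fromℕ (suc n) * c         ∎
  where open ≡-Reasoning

sum-telescope : ∀ n f → sumBelow n f + f n ≡ sumBelow n (λ i → f (suc i)) + f 0
sum-telescope zero    f = refl
sum-telescope (suc n) f = begin
  (sumBelow n f + f n) + f (suc n)
    ≡⟨ cong (_+ f (suc n)) (sum-telescope n f) ⟩
  (sumBelow n (λ i → f (suc i)) + f 0) + f (suc n)
    ≡⟨ solve 3 (λ a b c → (a :+ b) :+ c := (a :+ c) :+ b) refl (sumBelow n (λ i → f (suc i))) (f 0) (f (suc n)) ⟩
  (sumBelow n (λ i → f (suc i)) + f (suc n)) + f 0 ∎
  where open ≡-Reasoning

sum-+ : ∀ m n f → sumBelow (m ℕ.+ n) f ≡ sumBelow m f + sumBelow n (λ j → f (m ℕ.+ j))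
sum-+ m zero    f = trans (cong (λ k → sumBelow k f) (ℕ.+-identityʳ m)) (sym (+-identityʳ _))
sum-+ m (suc n) f = begin
  sumBelow (m ℕ.+ suc n) f
    ≡⟨ cong (λ k → sumBelow k f) (ℕ.+-suc m n) ⟩
  sumBelow (m ℕ.+ n) f + f (m ℕ.+ n)
    ≡⟨ cong (_+ f (m ℕ.+ n)) (sum-+ m n f) ⟩
  (sumBelow m f + sumBelow n (λ j → f (m ℕ.+ j))) + f (m ℕ.+ n)
    ≡⟨ +-assoc (sumBelow m f) _ _ ⟩
  sumBelow m f + (sumBelow n (λ j → f (m ℕ.+ j)) + f (m ℕ.+ n)) ∎
  where open ≡-Reasoning

sum-blocks : ∀ m n f →
  sumBelow (m ℕ.* n) f ≡ sumBelow m (λ i → sumBelow n (λ j → f (i ℕ.* n ℕ.+ j)))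
sum-blocks zero    n f = refl
sum-blocks (suc m) n f = begin
  sumBelow (n ℕ.+ m ℕ.* n) f
    ≡⟨ cong (λ k → sumBelow k f) (ℕ.+-comm n (m ℕ.* n)) ⟩
  sumBelow (m ℕ.* n ℕ.+ n) f
    ≡⟨ sum-+ (m ℕ.* n) n f ⟩
  sumBelow (m ℕ.* n) f + sumBelow n (λ j → f (m ℕ.* n ℕ.+ j))
    ≡⟨ cong (_+ sumBelow n (λ j → f (m ℕ.* n ℕ.+ j))) (sum-blocks m n f) ⟩
  sumBelow m (λ i → sumBelow n (λ j → f (i ℕ.* n ℕ.+ j)))
    + sumBelow n (λ j → f (m ℕ.* n ℕ.+ j)) ∎
  where open ≡-Reasoning

record ℝ : Set where
  field
    seq    : ℕ → ℚ
    cauchy : ∀ ε → 0ℚ < ε →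
             ∃[ N ] (∀ m n → N ℕ.≤ m → N ℕ.≤ n → ∣ seq m - seq n ∣ ≤ ε)

open ℝ public

infix  4 _<ℝ_
infixl 7 _*ℝ_ _/ℝ_[_]

_<ℝ_ : ℝ → ℝ → Set
x <ℝ y = ∃[ ε ] 0ℚ < ε × ∃[ N ] (∀ n → N ℕ.≤ n → seq x n + ε ≤ seq y n)

fromℚ : ℚ → ℝ
fromℚ p .seq _ = p
fromℚ p .cauchy ε 0<ε = 0 , λ _ _ _ _ →
  subst (_≤ ε) (sym (cong ∣_∣ (+-inverseʳ p))) (<⇒≤ 0<ε)

0ℝ : ℝ
0ℝ = fromℚ 0ℚ

bounded : ∀ x → ∃[ B ] 0ℚ < B × ∃[ N ] (∀ n → N ℕ.≤ n → ∣ seq x n ∣ ≤ B)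
bounded x with cauchy x 1ℚ (positive⁻¹ 1ℚ)
... | N , close =
  ∣ seq x N ∣ + 1ℚ , 0<B , N , λ n N≤n → begin
    ∣ seq x n ∣
      ≡⟨ cong ∣_∣ (solve 2 (λ a b → a := b :+ (a :- b)) refl (seq x n) (seq x N)) ⟩
    ∣ seq x N + (seq x n - seq x N) ∣
      ≤⟨ ∣p+q∣≤∣p∣+∣q∣ (seq x N) (seq x n - seq x N) ⟩
    ∣ seq x N ∣ + ∣ seq x n - seq x N ∣
      ≤⟨ +-monoʳ-≤ ∣ seq x N ∣ (close n N N≤n ℕ.≤-refl) ⟩
    ∣ seq x N ∣ + 1ℚ ∎
  where
  open ≤-Reasoning
  0<B : 0ℚ < ∣ seq x N ∣ + 1ℚ
  0<B = +-mono-≤-< (0≤∣p∣ (seq x N)) (positive⁻¹ 1ℚ)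

halves : ∀ ε → ½ * ε + ½ * ε ≡ ε
halves ε = trans (sym (*-distribʳ-+ ε ½ ½)) (*-identityˡ ε)

product-close : ∀ {A B ε} a b c d → 0ℚ < A → 0ℚ < B → ∣ a ∣ ≤ A → ∣ d ∣ ≤ B →
                ∣ a - b ∣ ≤ ½ * ε * recip B → ∣ c - d ∣ ≤ ½ * ε * recip A →
                ∣ a * c - b * d ∣ ≤ ε
product-close {A} {B} {ε} a b c d 0<A 0<B a≤A d≤B ab cd = begin
  ∣ a * c - b * d ∣
    ≡⟨ cong ∣_∣ (solve 4 (λ a b c d → a :* c :- b :* d := a :* (c :- d) :+ d :* (a :- b))
         refl a b c d) ⟩
  ∣ a * (c - d) + d * (a - b) ∣
    ≤⟨ ∣p+q∣≤∣p∣+∣q∣ (a * (c - d)) (d * (a - b)) ⟩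
  ∣ a * (c - d) ∣ + ∣ d * (a - b) ∣
    ≡⟨ cong₂ _+_ (∣p*q∣≡∣p∣*∣q∣ a (c - d)) (∣p*q∣≡∣p∣*∣q∣ d (a - b)) ⟩
  ∣ a ∣ * ∣ c - d ∣ + ∣ d ∣ * ∣ a - b ∣
    ≤⟨ +-mono-≤ (*-mono (0≤∣p∣ (c - d)) (<⇒≤ 0<A) a≤A cd)
                (*-mono (0≤∣p∣ (a - b)) (<⇒≤ 0<B) d≤B ab) ⟩
  A * (½ * ε * recip A) + B * (½ * ε * recip B)
    ≡⟨ cong₂ _+_ (cancel 0<A) (cancel 0<B) ⟩
  ½ * ε + ½ * ε
    ≡⟨ halves ε ⟩
  ε ∎
  where
  open ≤-Reasoning
  cancel : ∀ {p} → 0ℚ < p → p * (½ * ε * recip p) ≡ ½ * ε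
  cancel {p} 0<p =
    trans (solve 3 (λ a b c → a :* (c :* b) := c :* (a :* b)) refl p (recip p) (½ * ε))
          (trans (cong (½ * ε *_) (recip-inverse 0<p)) (*-identityʳ (½ * ε)))

_*ℝ_ : ℝ → ℝ → ℝ
(x *ℝ y) .seq n = seq x n * seq y n
(x *ℝ y) .cauchy ε 0<ε =
  let A , 0<A , M₁ , x≤A = bounded x
      B , 0<B , M₂ , y≤B = bounded y
      M = M₁ ℕ.⊔ M₂
      N₁ , x-close = cauchy x (½ * ε * recip B) (*-pos (*-pos (positive⁻¹ ½) 0<ε) (recip-pos 0<B))
      N₂ , y-close = cauchy y (½ * ε * recip A) (*-pos (*-pos (positive⁻¹ ½) 0<ε) (recip-pos 0<A))
      N = N₁ ℕ.⊔ N₂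
  in M ℕ.⊔ N , λ m n le le′ →
  product-close (seq x m) (seq x n) (seq y m) (seq y n) 0<A 0<B
    (x≤A m (ℕ.m⊔n≤o⇒m≤o M₁ M₂ (ℕ.m⊔n≤o⇒m≤o M N le)))
    (y≤B n (ℕ.m⊔n≤o⇒n≤o M₁ M₂ (ℕ.m⊔n≤o⇒m≤o M N le′)))
    (x-close m n (ℕ.m⊔n≤o⇒m≤o N₁ N₂ (ℕ.m⊔n≤o⇒n≤o M N le)) (ℕ.m⊔n≤o⇒m≤o N₁ N₂ (ℕ.m⊔n≤o⇒n≤o M N le′)))
    (y-close m n (ℕ.m⊔n≤o⇒n≤o N₁ N₂ (ℕ.m⊔n≤o⇒n≤o M N le)) (ℕ.m⊔n≤o⇒n≤o N₁ N₂ (ℕ.m⊔n≤o⇒n≤o M N le′)))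

recip-close : ∀ {η ε} a b → 0ℚ < η → η ≤ a → η ≤ b → ∣ b - a ∣ ≤ ε * (η * η) →
              ∣ recip a - recip b ∣ ≤ ε
recip-close {η} {ε} a b 0<η η≤a η≤b ab = begin
  ∣ recip a - recip b ∣
    ≡⟨ cong ∣_∣ (recip-difference 0<a 0<b) ⟩
  ∣ (b - a) * (recip a * recip b) ∣
    ≡⟨ ∣p*q∣≡∣p∣*∣q∣ (b - a) (recip a * recip b) ⟩
  ∣ b - a ∣ * ∣ recip a * recip b ∣
    ≡⟨ cong (∣ b - a ∣ *_) (0≤p⇒∣p∣≡p 0≤ra*rb) ⟩
  ∣ b - a ∣ * (recip a * recip b)
    ≤⟨ *-mono 0≤ra*rb (≤-trans (0≤∣p∣ (b - a)) ab) ab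
         (*-mono (<⇒≤ (recip-pos 0<b)) (<⇒≤ (recip-pos 0<η))
           (recip-antitone 0<η η≤a) (recip-antitone 0<η η≤b)) ⟩
  ε * (η * η) * (recip η * recip η)
    ≡⟨ solve 3 (λ e u v → e :* (u :* u) :* (v :* v) := e :* ((u :* v) :* (u :* v))) refl ε η (recip η) ⟩
  ε * ((η * recip η) * (η * recip η))
    ≡⟨ cong (λ u → ε * (u * u)) (recip-inverse 0<η) ⟩
  ε * 1ℚ
    ≡⟨ *-identityʳ ε ⟩
  ε ∎
  where
  open ≤-Reasoning
  0<a = <-≤-trans 0<η η≤a
  0<b = <-≤-trans 0<η η≤b
  0≤ra*rb = *-nonneg (<⇒≤ (recip-pos 0<a)) (<⇒≤ (recip-pos 0<b))

recipℝ : (x : ℝ) → 0ℝ <ℝ x → ℝ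
recipℝ x _ .seq n = recip (seq x n)
recipℝ x (η , 0<η , M , η≤x) .cauchy ε 0<ε =
  let N , close = cauchy x (ε * (η * η)) (*-pos 0<ε (*-pos 0<η 0<η))
  in M ℕ.⊔ N , λ m n le le′ →
  recip-close (seq x m) (seq x n) 0<η
    (bound m (ℕ.m⊔n≤o⇒m≤o M N le)) (bound n (ℕ.m⊔n≤o⇒m≤o M N le′))
    (close n m (ℕ.m⊔n≤o⇒n≤o M N le′) (ℕ.m⊔n≤o⇒n≤o M N le))
  where
  bound : ∀ n → M ℕ.≤ n → η ≤ seq x n
  bound n le = subst (_≤ seq x n) (+-identityˡ η) (η≤x n le)

_/ℝ_[_] : (x y : ℝ) → 0ℝ <ℝ y → ℝ
x /ℝ y [ 0<y ] = x *ℝ recipℝ y 0<y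

module AntitoneSums (φ : ℚ → ℚ)
  (antitone : ∀ {s t} → 0ℚ ≤ s → s ≤ t → t ≤ 1ℚ → φ t ≤ φ s) where

  node : ℕ → ℕ → ℚ
  node n k = fromℕ k * recip (fromℕ n)

  lowerSum upperSum : ℕ → ℚ
  lowerSum n = sumBelow n (λ i → recip (fromℕ n) * φ (node n (suc i)))
  upperSum n = sumBelow n (λ i → recip (fromℕ n) * φ (node n i))

  weight-nonneg : ∀ n → 0ℚ ≤ recip (fromℕ (suc n))
  weight-nonneg n = <⇒≤ (recip-pos (fromℕ-pos n))

  node-nonneg : ∀ n k → 0ℚ ≤ node (suc n) k
  node-nonneg n k = *-nonneg (fromℕ-nonneg k) (weight-nonneg n)

  node-mono : ∀ n {k l} → k ℕ.≤ l → node (suc n) k ≤ node (suc n) l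
  node-mono n k≤l = *-monoˡ (weight-nonneg n) (fromℕ-mono-≤ k≤l)

  node-≤1 : ∀ n {k} → k ℕ.≤ suc n → node (suc n) k ≤ 1ℚ
  node-≤1 n {k} k≤n = subst (node (suc n) k ≤_) (recip-inverse (fromℕ-pos n)) (node-mono n k≤n)

  node-antitone : ∀ n {k l} → k ℕ.≤ l → l ℕ.≤ suc n → φ (node (suc n) l) ≤ φ (node (suc n) k)
  node-antitone n {k} k≤l l≤n = antitone (node-nonneg n k) (node-mono n k≤l) (node-≤1 n l≤n)

  node-refine : ∀ m n k → node (suc m ℕ.* suc n) (k ℕ.* suc n) ≡ node (suc m) k
  node-refine m n k = begin
    fromℕ (k ℕ.* suc n) * recip (fromℕ (suc m ℕ.* suc n))
      ≡⟨ cong₂ (λ u v → u * recip v) (fromℕ-* k (suc n)) (fromℕ-* (suc m) (suc n)) ⟩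
    (fromℕ k * N) * recip (M * N)
      ≡⟨ cong ((fromℕ k * N) *_) (recip-* (fromℕ-pos m) (fromℕ-pos n)) ⟩
    (fromℕ k * N) * (recip M * recip N)
      ≡⟨ solve 4 (λ a b c d → (a :* b) :* (c :* d) := (a :* c) :* (b :* d)) refl (fromℕ k) N (recip M) (recip N) ⟩
    (fromℕ k * recip M) * (N * recip N)
      ≡⟨ cong ((fromℕ k * recip M) *_) (recip-inverse (fromℕ-pos n)) ⟩
    (fromℕ k * recip M) * 1ℚ
      ≡⟨ *-identityʳ _ ⟩
    fromℕ k * recip M ∎
    where
    open ≡-Reasoning
    M = fromℕ (suc m)
    N = fromℕ (suc n)

  block-const : ∀ m n c →
    sumBelow (suc n) (λ _ → recip (fromℕ (suc m ℕ.* suc n)) * c) ≡ recip (fromℕ (suc m)) * c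
  block-const m n c = begin
    sumBelow (suc n) (λ _ → recip (fromℕ (suc m ℕ.* suc n)) * c)
      ≡⟨ sum-const (suc n) _ ⟩
    N * (recip (fromℕ (suc m ℕ.* suc n)) * c)
      ≡⟨ cong (λ u → N * (recip u * c)) (fromℕ-* (suc m) (suc n)) ⟩
    N * (recip (M * N) * c)
      ≡⟨ cong (λ u → N * (u * c)) (recip-* (fromℕ-pos m) (fromℕ-pos n)) ⟩
    N * ((recip M * recip N) * c)
      ≡⟨ solve 4 (λ a b c d → a :* ((b :* c) :* d) := (a :* c) :* (b :* d)) refl N (recip M) (recip N) c ⟩
    (N * recip N) * (recip M * c)
      ≡⟨ cong (_* (recip M * c)) (recip-inverse (fromℕ-pos n)) ⟩
    1ℚ * (recip M * c)
      ≡⟨ *-identityˡ _ ⟩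
    recip M * c ∎
    where
    open ≡-Reasoning
    M = fromℕ (suc m)
    N = fromℕ (suc n)

  block-end : ∀ {m n i j} → i ℕ.< m → j ℕ.< n → i ℕ.* n ℕ.+ suc j ℕ.≤ suc i ℕ.* n
  block-end {m} {n} {i} {j} i<m j<n =
    subst (i ℕ.* n ℕ.+ suc j ℕ.≤_) (ℕ.+-comm (i ℕ.* n) n) (ℕ.+-monoʳ-≤ (i ℕ.* n) j<n)

  lowerSum-refine : ∀ m n → lowerSum (suc m) ≤ lowerSum (suc m ℕ.* suc n)
  lowerSum-refine m n = begin
    sumBelow (suc m) (λ i → recip (fromℕ (suc m)) * φ (node (suc m) (suc i)))
      ≡⟨ sum-cong (suc m) (λ i → trans
           (cong (λ u → recip (fromℕ (suc m)) * φ u) (sym (node-refine m n (suc i))))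
           (sym (block-const m n _))) ⟩
    sumBelow (suc m) (λ i → sumBelow (suc n) (λ j → w * φ (node MN (suc i ℕ.* suc n))))
      ≤⟨ sum-mono (suc m) (λ i i<m → sum-mono (suc n) (λ j j<n → *-monoʳ (weight-nonneg (n ℕ.+ m ℕ.* suc n))
           (node-antitone (n ℕ.+ m ℕ.* suc n)
             (subst (ℕ._≤ suc i ℕ.* suc n) (ℕ.+-suc (i ℕ.* suc n) j) (block-end i<m j<n))
             (ℕ.*-monoˡ-≤ (suc n) i<m)))) ⟩
    sumBelow (suc m) (λ i → sumBelow (suc n) (λ j → w * φ (node MN (suc (i ℕ.* suc n ℕ.+ j)))))
      ≡⟨ sum-blocks (suc m) (suc n) (λ k → w * φ (node MN (suc k))) ⟨
    lowerSum MN ∎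
    where
    open ≤-Reasoning
    MN = suc m ℕ.* suc n
    w = recip (fromℕ MN)

  upperSum-refine : ∀ m n → upperSum (suc m ℕ.* suc n) ≤ upperSum (suc m)
  upperSum-refine m n = begin
    upperSum MN
      ≡⟨ sum-blocks (suc m) (suc n) (λ k → w * φ (node MN k)) ⟩
    sumBelow (suc m) (λ i → sumBelow (suc n) (λ j → w * φ (node MN (i ℕ.* suc n ℕ.+ j))))
      ≤⟨ sum-mono (suc m) (λ i i<m → sum-mono (suc n) (λ j j<n → *-monoʳ (weight-nonneg (n ℕ.+ m ℕ.* suc n))
           (node-antitone (n ℕ.+ m ℕ.* suc n)
             (ℕ.m≤m+n (i ℕ.* suc n) j)
             (ℕ.≤-trans (ℕ.+-monoʳ-≤ (i ℕ.* suc n) (ℕ.n≤1+n j))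
               (ℕ.≤-trans (block-end i<m j<n) (ℕ.*-monoˡ-≤ (suc n) i<m)))))) ⟩
    sumBelow (suc m) (λ i → sumBelow (suc n) (λ j → w * φ (node MN (i ℕ.* suc n))))
      ≡⟨ sum-cong (suc m) (λ i → trans
           (block-const m n _)
           (cong (λ u → recip (fromℕ (suc m)) * φ u) (node-refine m n i))) ⟩
    upperSum (suc m) ∎
    where
    open ≤-Reasoning
    MN = suc m ℕ.* suc n
    w = recip (fromℕ MN)

  lowerSum≤upperSum-same : ∀ n → lowerSum (suc n) ≤ upperSum (suc n)
  lowerSum≤upperSum-same n = sum-mono (suc n) (λ i i<n →
    *-monoʳ (weight-nonneg n) (node-antitone n (ℕ.n≤1+n i) i<n))

  lowerSum≤upperSum : ∀ m n → lowerSum (suc m) ≤ upperSum (suc n)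
  lowerSum≤upperSum m n = begin
    lowerSum (suc m)               ≤⟨ lowerSum-refine m n ⟩
    lowerSum (suc m ℕ.* suc n)     ≤⟨ lowerSum≤upperSum-same (n ℕ.+ m ℕ.* suc n) ⟩
    upperSum (suc m ℕ.* suc n)     ≡⟨ cong upperSum (ℕ.*-comm (suc m) (suc n)) ⟩
    upperSum (suc n ℕ.* suc m)     ≤⟨ upperSum-refine n m ⟩
    upperSum (suc n)               ∎
    where open ≤-Reasoning

  gap : ℚ
  gap = φ 0ℚ - φ 1ℚ

  gap-nonneg : 0ℚ ≤ gap
  gap-nonneg = p≤q⇒0≤q-p (antitone ≤-refl 0≤1 ≤-refl)

  upperSum-lowerSum : ∀ n → upperSum (suc n) - lowerSum (suc n) ≡ recip (fromℕ (suc n)) * gap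
  upperSum-lowerSum n = begin
    upperSum (suc n) - lowerSum (suc n)
      ≡⟨ solve 4 (λ u l a b → u :- l := (u :+ a) :- (l :+ b) :+ (b :- a)) refl
           (upperSum (suc n)) (lowerSum (suc n)) (f (suc n)) (f 0) ⟩
    (upperSum (suc n) + f (suc n)) - (lowerSum (suc n) + f 0) + (f 0 - f (suc n))
      ≡⟨ cong (λ u → u - (lowerSum (suc n) + f 0) + (f 0 - f (suc n))) (sum-telescope (suc n) f) ⟩
    (lowerSum (suc n) + f 0) - (lowerSum (suc n) + f 0) + (f 0 - f (suc n))
      ≡⟨ solve 3 (λ a b c → (a :- a) :+ (b :- c) := b :- c) refl (lowerSum (suc n) + f 0) (f 0) (f (suc n)) ⟩
    f 0 - f (suc n)
      ≡⟨ cong₂ (λ u v → w * φ u - w * φ v) (*-zeroˡ w) (recip-inverse (fromℕ-pos n)) ⟩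
    w * φ 0ℚ - w * φ 1ℚ
      ≡⟨ solve 3 (λ w a b → w :* a :- w :* b := w :* (a :- b)) refl w (φ 0ℚ) (φ 1ℚ) ⟩
    w * gap ∎
    where
    open ≡-Reasoning
    w = recip (fromℕ (suc n))
    f = λ k → w * φ (node (suc n) k)

  φ1≤lowerSum : ∀ n → φ 1ℚ ≤ lowerSum (suc n)
  φ1≤lowerSum n = begin
    φ 1ℚ
      ≡⟨ *-identityˡ (φ 1ℚ) ⟨
    1ℚ * φ 1ℚ
      ≡⟨ cong (_* φ 1ℚ) (recip-inverse (fromℕ-pos n)) ⟨
    (fromℕ (suc n) * recip (fromℕ (suc n))) * φ 1ℚ
      ≡⟨ *-assoc (fromℕ (suc n)) _ _ ⟩
    fromℕ (suc n) * (recip (fromℕ (suc n)) * φ 1ℚ)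
      ≡⟨ sum-const (suc n) _ ⟨
    sumBelow (suc n) (λ _ → recip (fromℕ (suc n)) * φ 1ℚ)
      ≤⟨ sum-mono (suc n) (λ i i<n → *-monoʳ (weight-nonneg n)
           (antitone (node-nonneg n (suc i)) (node-≤1 n i<n) ≤-refl)) ⟩
    lowerSum (suc n) ∎
    where open ≤-Reasoning

  lowerSum-difference : ∀ m n → lowerSum (suc m) - lowerSum (suc n) ≤ recip (fromℕ (suc n)) * gap
  lowerSum-difference m n = subst (lowerSum (suc m) - lowerSum (suc n) ≤_)
    (upperSum-lowerSum n) (+-monoˡ-≤ (- lowerSum (suc n)) (lowerSum≤upperSum m n))

  lowerSum-cauchy : ∀ ε → 0ℚ < ε →
    ∃[ N ] (∀ m n → N ℕ.≤ m → N ℕ.≤ n → ∣ lowerSum (suc m) - lowerSum (suc n) ∣ ≤ ε)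
  lowerSum-cauchy ε 0<ε = N , λ m n N≤m N≤n →
    ∣p∣≤ (≤-trans (lowerSum-difference m n) (small n N≤n))
         (subst (_≤ ε) (solve 2 (λ a b → a :- b := :- (b :- a)) refl (lowerSum (suc n)) (lowerSum (suc m)))
           (≤-trans (lowerSum-difference n m) (small m N≤m)))
    where
    N = archimedean (gap * recip ε) .proj₁
    gap≤ = archimedean (gap * recip ε) .proj₂

    small : ∀ n → N ℕ.≤ n → recip (fromℕ (suc n)) * gap ≤ ε
    small n N≤n = begin
      w * gap                     ≡⟨ cong (w *_) (*-identityʳ gap) ⟨
      w * (gap * 1ℚ)              ≡⟨ cong (λ u → w * (gap * u)) (recip-inverse 0<ε) ⟨
      w * (gap * (ε * recip ε))   ≡⟨ solve 4 (λ w g e r → w :* (g :* (e :* r)) := (w :* e) :* (g :* r)) refl w gap ε (recip ε) ⟩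
      (w * ε) * (gap * recip ε)   ≤⟨ *-monoʳ (*-nonneg (weight-nonneg n) (<⇒≤ 0<ε))
                                       (≤-trans gap≤ (fromℕ-mono-≤ (ℕ.m≤n⇒m≤1+n N≤n))) ⟩
      (w * ε) * fromℕ (suc n)     ≡⟨ solve 3 (λ w e n → (w :* e) :* n := e :* (n :* w)) refl w ε (fromℕ (suc n)) ⟩
      ε * (fromℕ (suc n) * w)     ≡⟨ cong (ε *_) (recip-inverse (fromℕ-pos n)) ⟩
      ε * 1ℚ                      ≡⟨ *-identityʳ ε ⟩
      ε                           ∎
      where
      open ≤-Reasoning
      w = recip (fromℕ (suc n))

-- Right endpoints of n equal subintervals; h is negative when b < a.
riemannSum : (ℚ → ℚ) → ℚ → ℚ → ℕ → ℚ
riemannSum f a b n = sumBelow n (λ i → h * f (a + fromℕ (suc i) * h))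
  where h = (b - a) * recip (fromℕ n)

-- Substituting u = 1 + t (x - 1) turns ∫₁ˣ du/u into ∫₀¹ logIntegrand x t dt,
-- whose integrand is antitone whether x ≥ 1 or x ≤ 1.
logIntegrand : ℚ → ℚ → ℚ
logIntegrand x t = (x - 1ℚ) * recip (1ℚ + t * (x - 1ℚ))

logIntegrand-denominator-pos : ∀ {x t} → 0ℚ < x → 0ℚ ≤ t → t ≤ 1ℚ → 0ℚ < 1ℚ + t * (x - 1ℚ)
logIntegrand-denominator-pos {x} {t} 0<x 0≤t t≤1 with ≤-total 1ℚ x
... | inj₁ 1≤x = <-≤-trans (positive⁻¹ 1ℚ) (p≤p+q 1ℚ (*-nonneg 0≤t (p≤q⇒0≤q-p 1≤x)))
... | inj₂ x≤1 = <-≤-trans 0<x (0≤q-p⇒p≤q (subst (0ℚ ≤_)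
  (solve 2 (λ x t → (con 1ℚ :- t) :* (con 1ℚ :- x) := (con 1ℚ :+ t :* (x :- con 1ℚ)) :- x) refl x t)
  (*-nonneg (p≤q⇒0≤q-p t≤1) (p≤q⇒0≤q-p x≤1))))

logIntegrand-antitone : ∀ {x} → 0ℚ < x → ∀ {s t} → 0ℚ ≤ s → s ≤ t → t ≤ 1ℚ →
                        logIntegrand x t ≤ logIntegrand x s
logIntegrand-antitone {x} 0<x {s} {t} 0≤s s≤t t≤1 = 0≤q-p⇒p≤q (subst (0ℚ ≤_) (sym eq)
  (*-nonneg (*-nonneg (p≤q⇒0≤q-p s≤t) (square-nonneg c))
            (*-nonneg (<⇒≤ (recip-pos 0<u)) (<⇒≤ (recip-pos 0<v)))))
  where
  c = x - 1ℚ
  u = 1ℚ + s * c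
  v = 1ℚ + t * c
  0<u = logIntegrand-denominator-pos 0<x 0≤s (≤-trans s≤t t≤1)
  0<v = logIntegrand-denominator-pos 0<x (≤-trans 0≤s s≤t) t≤1
  open ≡-Reasoning
  eq : c * recip u - c * recip v ≡ ((t - s) * (c * c)) * (recip u * recip v)
  eq = begin
    c * recip u - c * recip v
      ≡⟨ solve 3 (λ c a b → c :* a :- c :* b := c :* (a :- b)) refl c (recip u) (recip v) ⟩
    c * (recip u - recip v)
      ≡⟨ cong (c *_) (recip-difference 0<u 0<v) ⟩
    c * ((v - u) * (recip u * recip v))
      ≡⟨ solve 6 (λ c s t o a b → c :* (((o :+ t :* c) :- (o :+ s :* c)) :* (a :* b))
                               := ((t :- s) :* (c :* c)) :* (a :* b))
           refl c s t 1ℚ (recip u) (recip v) ⟩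
    ((t - s) * (c * c)) * (recip u * recip v) ∎

module LogSums {x : ℚ} (0<x : 0ℚ < x) =
  AntitoneSums (logIntegrand x) (logIntegrand-antitone 0<x)

riemannSum≡lowerSum : ∀ {x} (0<x : 0ℚ < x) n →
                      riemannSum recip 1ℚ x n ≡ LogSums.lowerSum 0<x n
riemannSum≡lowerSum {x} 0<x n = sum-cong n λ i → trans
  (cong (λ u → (c * r) * recip (1ℚ + u))
    (solve 3 (λ k c r → k :* (c :* r) := (k :* r) :* c) refl (fromℕ (suc i)) c r))
  (solve 3 (λ c r q → (c :* r) :* q := r :* (c :* q)) refl c r
    (recip (1ℚ + (fromℕ (suc i) * r) * c)))
  where
  c = x - 1ℚ
  r = recip (fromℕ n)

-- log x is the limit of Riemann sums for ∫₁ˣ dt/t; the nth term uses n + 1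
-- subintervals, avoiding the degenerate empty partition.
log : (x : ℚ) → 0ℚ < x → ℝ
log x 0<x .seq n = riemannSum recip 1ℚ x (suc n)
log x 0<x .cauchy ε 0<ε =
  let N , close = LogSums.lowerSum-cauchy 0<x ε 0<ε
  in N , λ m n N≤m N≤n → subst (_≤ ε)
    (sym (cong₂ (λ u v → ∣ u - v ∣) (riemannSum≡lowerSum 0<x (suc m)) (riemannSum≡lowerSum 0<x (suc n))))
    (close m n N≤m N≤n)

log-pos : ∀ {x} (0<x : 0ℚ < x) → 1ℚ < x → 0ℝ <ℝ log x 0<x
log-pos {x} 0<x 1<x = logIntegrand x 1ℚ , 0<φ1 , 0 , λ n _ →
  subst₂ _≤_ (sym (+-identityˡ (logIntegrand x 1ℚ))) (sym (riemannSum≡lowerSum 0<x (suc n)))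
    (LogSums.φ1≤lowerSum 0<x n)
  where
  0<φ1 : 0ℚ < logIntegrand x 1ℚ
  0<φ1 = *-pos (p<q⇒0<q-p 1<x) (recip-pos (logIntegrand-denominator-pos 0<x 0≤1 ≤-refl))

numerators : ℕ → List ℕ
numerators q = filter (λ a → gcd a q ℕ.≟ 1) (map suc (upTo q))

-- Distinct pairs (a , q) with gcd a q = 1 give distinct fractions a / q, so the
-- list has no repetitions.
fareyFractions : ℕ → List ℚ
fareyFractions Q = concatMap (λ q-1 → map (λ a → + a / suc q-1) (numerators (suc q-1))) (upTo Q)

farey : ℕ → List ℚ
farey Q = sort (fareyFractions Q)

sumSquaredGaps : List ℚ → ℚ
sumSquaredGaps (γ ∷ γ′ ∷ γs) = (γ′ - γ) * (γ′ - γ) + sumSquaredGaps (γ′ ∷ γs)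
sumSquaredGaps _             = 0ℚ

S₂ : ℕ → ℚ
S₂ Q = sumSquaredGaps (farey Q)

0<fromℕ : ∀ {n} → 1 ℕ.< n → 0ℚ < fromℕ n
0<fromℕ 1<n = fromℕ-mono-< (ℕ.<-trans (ℕ.s≤s ℕ.z≤n) 1<n)

C : (Q : ℕ) → 1 ℕ.< Q → ℝ
C Q 1<Q = fromℚ (S₂ Q * fromℕ (Q ℕ.^ 2)) /ℝ log (fromℕ Q) 0<Q [ log-pos 0<Q (fromℕ-mono-< 1<Q) ]
  where
  0<Q = 0<fromℕ 1<Q

-- Inserting points between the extreme elements only decreases the sum of squared gaps, so
-- S₂ Q is at most the sum for the list obtained by inserting mediants of denominator ≤ Q; its
-- gaps are 1/(x y) with x, y adjacent denominators.  As the order grows, adjacent pairs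
-- (x , y) with x + y = Q + 1 are replaced by (x , Q + 1) and (Q + 1 , y), so no pair with
-- 1 ≤ x, y ≤ Q < x + y occurs twice.  Leaving out the pair (1 , Q), which belongs to the gap
-- before 1/Q, and using 1/y² ≤ 1/(y - ½) - 1/(y + ½) and partial fractions,
--   Q² S₂(Q) ≤ Q² Σ 1/(x y)² - 1 ≤ 8 (Q / (2 Q + 1))² H(2 Q) - 1,
-- where H is the harmonic number.  A Riemann sum of mesh ½ gives log Q ≥ H(2 Q) - 3/2, and the
-- two bounds are compared directly: for Q ≥ 10 since H(20) > 7/2, for Q < 10 numerically.
module Submission where

open import Defs
import Data.Integer.Base as ℤ
import Data.Integer.Properties as ℤ
open import Data.Nat.Base as ℕ using (ℕ; zero; suc)
import Data.Nat.Properties as ℕ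
open import Data.Nat.Divisibility using (_∣_; ∣1⇒≡1; ∣m+n∣m⇒∣n; ∣-trans; m∣m*n; n∣m*n)
open import Data.Nat.GCD using (gcd; gcd[m,n]∣m; gcd[m,n]∣n)
open import Data.List.Base using (List; []; _∷_; map; upTo)
open import Data.List.Membership.Propositional using (_∈_; lose; find)
open import Data.List.Membership.Propositional.Properties
  using (∈-concatMap⁺; ∈-concatMap⁻; ∈-map⁺; ∈-map⁻; ∈-filter⁺; ∈-filter⁻; ∈-upTo⁺; ∈-upTo⁻)
open import Data.List.Relation.Binary.Permutation.Propositional using (↭-sym)
open import Data.List.Relation.Binary.Permutation.Propositional.Properties using (∈-resp-↭)
open import Data.List.Relation.Unary.All as All using (All; []; _∷_)
import Data.List.Relation.Unary.All.Properties as All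
open import Data.List.Relation.Unary.AllPairs as AllPairs using (AllPairs; []; _∷_)
open import Data.List.Relation.Unary.Any using (here; there)
open import Data.List.Relation.Unary.Linked as Linked using (Linked; []; [-]; _∷_)
import Data.List.Relation.Unary.Linked.Properties as Linked
open import Data.List.Relation.Unary.Sorted.TotalOrder.Properties using (Sorted⇒AllPairs)
open import Data.Product using (∃-syntax; _×_; _,_; proj₁; proj₂)
open import Data.Rational
open import Data.Rational.Properties
open import Data.List.Sort.InsertionSort.Properties ≤-decTotalOrder using (sort-↭; sort-↗)
import Data.Rational.Unnormalised as ℚᵘ
import Data.Rational.Unnormalised.Properties as ℚᵘ
open import Data.Rational.Solver using (module +-*-Solver)
open import Relation.Binary.Bundles using (DecTotalOrder)
open import Relation.Binary.PropositionalEquality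
open import Relation.Nullary using (Dec; yes; no; contradiction)
open import Relation.Nullary.Decidable using (from-yes)

open +-*-Solver using (solve; _:+_; _:*_; _:-_; _:=_; con)

-- Finite sums and reciprocals of natural numbers

0<q-p⇒p<q : ∀ {p q} → 0ℚ < q - p → p < q
0<q-p⇒p<q {p} {q} 0<q-p = subst₂ _<_ (+-identityʳ p)
  (solve 2 (λ p q → p :+ (q :- p) := q) refl p q) (+-monoʳ-< p 0<q-p)

sum-add : ∀ n f g → sumBelow n (λ i → f i + g i) ≡ sumBelow n f + sumBelow n g
sum-add zero    f g = refl
sum-add (suc n) f g = trans (cong (_+ (f n + g n)) (sum-add n f g))
  (solve 4 (λ a b c d → (a :+ b) :+ (c :+ d) := (a :+ c) :+ (b :+ d))
     refl (sumBelow n f) (sumBelow n g) (f n) (g n))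

sum-suc : ∀ n f → sumBelow (suc n) f ≡ f 0 + sumBelow n (λ i → f (suc i))
sum-suc n f = trans (sum-telescope n f) (+-comm _ (f 0))

-- Serves identities with truncated subtraction, which hold only at indices below `n`.
sum-cong-< : ∀ n {f g} → (∀ i → i ℕ.< n → f i ≡ g i) → sumBelow n f ≡ sumBelow n g
sum-cong-< n eq = ≤-antisym (sum-mono n (λ i i<n → ≤-reflexive (eq i i<n)))
                            (sum-mono n (λ i i<n → ≤-reflexive (sym (eq i i<n))))

sum-reverse : ∀ n f → sumBelow n (λ i → f (n ℕ.∸ suc i)) ≡ sumBelow n f
sum-reverse zero    f = refl
sum-reverse (suc n) f = begin
  sumBelow (suc n) (λ i → f (n ℕ.∸ i))             ≡⟨ sum-suc n _ ⟩
  f n + sumBelow n (λ i → f (n ℕ.∸ suc i))         ≡⟨ cong (f n +_) (sum-reverse n f) ⟩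
  f n + sumBelow n f                               ≡⟨ +-comm (f n) _ ⟩
  sumBelow (suc n) f                               ∎
  where open ≡-Reasoning

⅟ : ℕ → ℚ
⅟ n = recip (fromℕ n)

2ℚ : ℚ
2ℚ = 1ℚ + 1ℚ

⅟-pos : ∀ n → 0ℚ < ⅟ (suc n)
⅟-pos n = recip-pos (fromℕ-pos n)

⅟-nonneg : ∀ n → 0ℚ ≤ ⅟ (suc n)
⅟-nonneg n = <⇒≤ (⅟-pos n)

⅟-pos′ : ∀ {n} → 0 ℕ.< n → 0ℚ < ⅟ n
⅟-pos′ 0<n = recip-pos (fromℕ-mono-< 0<n)

⅟-inverse : ∀ n → fromℕ (suc n) * ⅟ (suc n) ≡ 1ℚ
⅟-inverse n = recip-inverse (fromℕ-pos n)

fromℕ-2* : ∀ n → fromℕ (2 ℕ.* n) ≡ 2ℚ * fromℕ n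
fromℕ-2* n = fromℕ-* 2 n

fromℕ-1+2* : ∀ n → fromℕ (suc (2 ℕ.* n)) ≡ 2ℚ * fromℕ n + 1ℚ
fromℕ-1+2* n = trans (fromℕ-suc (2 ℕ.* n)) (cong (_+ 1ℚ) (fromℕ-2* n))

⅟-double : ∀ n → ⅟ (suc n) ≡ 2ℚ * ⅟ (2 ℕ.* suc n)
⅟-double n = begin
  ⅟ (suc n)                                ≡⟨ *-identityˡ _ ⟨
  1ℚ * ⅟ (suc n)                           ≡⟨⟩
  (2ℚ * ⅟ 2) * ⅟ (suc n)                   ≡⟨ *-assoc 2ℚ (⅟ 2) (⅟ (suc n)) ⟩
  2ℚ * (⅟ 2 * ⅟ (suc n))                   ≡⟨ cong (2ℚ *_) (recip-* (fromℕ-pos 1) (fromℕ-pos n)) ⟨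
  2ℚ * recip (fromℕ 2 * fromℕ (suc n))     ≡⟨ cong (λ u → 2ℚ * recip u) (fromℕ-* 2 (suc n)) ⟨
  2ℚ * ⅟ (2 ℕ.* suc n)                     ∎
  where open ≡-Reasoning

-- Sums of squared gaps

last⁺ : {A : Set} → A → List A → A
last⁺ x []       = x
last⁺ x (y ∷ ys) = last⁺ y ys

last⁺-map : ∀ {A B : Set} (f : A → B) x xs → last⁺ (f x) (map f xs) ≡ f (last⁺ x xs)
last⁺-map f x []       = refl
last⁺-map f x (y ∷ ys) = last⁺-map f y ys

-- With u = q - p and v = r - q, both nonnegative, the right side exceeds the left by 2 u v.
drop-gap : ∀ {p q r} → p ≤ q → q ≤ r → (q - p) * (q - p) + (r - q) * (r - q) ≤ (r - p) * (r - p)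
drop-gap {p} {q} {r} p≤q q≤r = 0≤q-p⇒p≤q (subst (0ℚ ≤_)
  (solve 3 (λ p q r → (q :- p) :* (r :- q) :+ (q :- p) :* (r :- q)
                   := (r :- p) :* (r :- p) :- ((q :- p) :* (q :- p) :+ (r :- q) :* (r :- q))) refl p q r)
  (+-mono-≤ 0≤c 0≤c))
  where
  0≤c = *-nonneg (p≤q⇒0≤q-p p≤q) (p≤q⇒0≤q-p q≤r)

sumSquaredGaps-∷ : ∀ p qs → sumSquaredGaps qs ≤ sumSquaredGaps (p ∷ qs)
sumSquaredGaps-∷ p []       = ≤-refl
sumSquaredGaps-∷ p (q ∷ qs) = subst (_≤ (q - p) * (q - p) + sumSquaredGaps (q ∷ qs)) (+-identityˡ _)
  (+-monoˡ-≤ (sumSquaredGaps (q ∷ qs)) (square-nonneg (q - p)))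

-- The witness `r` rules out an empty `qs`: there, `q` would lengthen the list and add a gap instead
-- of splitting one.
sumSquaredGaps-insert : ∀ {p q qs} → p ≤ q → All (q ≤_) qs → ∃[ r ] r ∈ qs →
                        sumSquaredGaps (p ∷ q ∷ qs) ≤ sumSquaredGaps (p ∷ qs)
sumSquaredGaps-insert {p} {q} {r ∷ rs} p≤q (q≤r ∷ _) _ = subst (_≤ _)
  (+-assoc ((q - p) * (q - p)) ((r - q) * (r - q)) (sumSquaredGaps (r ∷ rs)))
  (+-monoˡ-≤ (sumSquaredGaps (r ∷ rs)) (drop-gap p≤q q≤r))

sumSquaredGaps-const : ∀ {p} qs → All (p ≤_) qs → All (_≤ p) qs → sumSquaredGaps (p ∷ qs) ≤ 0ℚ
sumSquaredGaps-const         []       _           _           = ≤-refl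
sumSquaredGaps-const {p} (q ∷ qs) (p≤q ∷ p≤qs) (q≤p ∷ qs≤p) with refl ← ≤-antisym p≤q q≤p =
  subst (λ d → d * d + sumSquaredGaps (p ∷ qs) ≤ 0ℚ) (sym (+-inverseʳ p))
    (subst (_≤ 0ℚ) (sym (+-identityˡ _)) (sumSquaredGaps-const qs p≤qs qs≤p))

-- Walk along the fine list `qs`. If its head is the next coarse point `n`, both lists advance;
-- otherwise the head is dropped by `sumSquaredGaps-insert`, with `n` still ahead as the required
-- later element.
sumSquaredGaps-refine : ∀ {p} qs ns → All (p ≤_) qs → AllPairs _≤_ qs →
                        AllPairs _<_ ns → All (_∈ qs) ns → All (_≤ last⁺ p ns) qs →
                        sumSquaredGaps (p ∷ qs) ≤ sumSquaredGaps (p ∷ ns)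
-- With no coarse points left, `last⁺ p ns` is `p` itself, which squeezes all of `qs` to `p`.
sumSquaredGaps-refine qs []       p≤ _ _ _ ≤p = sumSquaredGaps-const qs p≤ ≤p
sumSquaredGaps-refine {p} (q ∷ qs) (n ∷ ns) (p≤q ∷ p≤) (q≤ ∷ ↗) (n< ∷ n↗) (n∈ ∷ ns∈) (_ ∷ ≤l)
  with n ≟ q
... | yes refl = +-monoʳ-≤ ((q - p) * (q - p)) (sumSquaredGaps-refine qs ns q≤ ↗ n↗
        -- Later coarse points exceed `n`, which is now `q`, so they lie in the tail `qs`.
        (All.zipWith (λ { (n<m , here refl) → contradiction n<m (<-irrefl refl)
                        ; (n<m , there m∈)  → m∈ }) (n< , ns∈)) ≤l)
... | no n≢q with n∈
...   | here n≡q   = contradiction n≡q n≢q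
...   | there n∈qs = ≤-trans (sumSquaredGaps-insert p≤q q≤ (n , n∈qs))
        (sumSquaredGaps-refine qs (n ∷ ns) p≤ ↗ (n< ∷ n↗)
          -- A later coarse point equal to `q` would give n < q, but q ≤ n because `n` lies in the
          -- sorted tail.
          (n∈qs ∷ All.zipWith (λ { (n<m , here refl) → contradiction (<-≤-trans n<m (All.lookup q≤ n∈qs))
                                                                (<-irrefl refl)
                                 ; (n<m , there m∈)  → m∈ }) (n< , ns∈)) ≤l)

-- Farey sequences by mediants

Fraction : Set
Fraction = ℕ × ℕ

mediant : Fraction → Fraction → Fraction
mediant (a , b) (c , d) = a ℕ.+ c , b ℕ.+ d

-- The step from order n - 1 to order n: a fraction of denominator n enters as the mediant of two
-- neighbours whose denominators add up to n. The starting fraction `p` is not part of the output.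
refine : ℕ → Fraction → List Fraction → List Fraction
refine n p []       = []
refine n p (q ∷ qs) with proj₂ p ℕ.+ proj₂ q ℕ.≟ n
... | yes _ = mediant p q ∷ q ∷ refine n q qs
... | no  _ = q ∷ refine n q qs

-- The Farey sequence of order q + 1 without its first element 1 / (q + 1).
fareyTail : ℕ → List Fraction
fareyTail zero    = []
fareyTail (suc q) = (1 , suc q) ∷ refine (suc (suc q)) (1 , suc q) (fareyTail q)

record Proper (n : ℕ) (p : Fraction) : Set where
  constructor proper
  field
    0<numerator   : 0 ℕ.< proj₁ p
    num≤den       : proj₁ p ℕ.≤ proj₂ p
    den≤bound     : proj₂ p ℕ.≤ n

-- For neighbours a/b and c/d, `determinant` is the unimodular relation c b - a d = 1, written
-- without subtraction.
record Adjacent (n : ℕ) (p q : Fraction) : Set where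
  constructor adjacent
  field
    properˡ     : Proper n p
    properʳ     : Proper n q
    determinant : proj₁ q ℕ.* proj₂ p ≡ suc (proj₁ p ℕ.* proj₂ q)

open Proper
open Adjacent

Proper-suc : ∀ {n p} → Proper n p → Proper (suc n) p
Proper-suc (proper 0<a a≤b b≤n) = proper 0<a a≤b (ℕ.m≤n⇒m≤1+n b≤n)

Adjacent-suc : ∀ {n p q} → Adjacent n p q → Adjacent (suc n) p q
Adjacent-suc (adjacent P Q det) = adjacent (Proper-suc P) (Proper-suc Q) det

Proper-mediant : ∀ {n m p q} → Proper n p → Proper n q → proj₂ p ℕ.+ proj₂ q ≡ m → Proper m (mediant p q)
Proper-mediant (proper 0<a a≤b _) (proper _ c≤d _) eq =
  proper (ℕ.m≤n⇒m≤n+o _ 0<a) (ℕ.+-mono-≤ a≤b c≤d) (ℕ.≤-reflexive eq)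

-- Adding one fraction to the other componentwise leaves the determinant unchanged: (a + c) b - a (b
-- + d) = c b - a d. The other half, `Adjacent-mediantʳ`, is the same computation.
Adjacent-mediantˡ : ∀ {n p q} → Adjacent n p q → proj₂ p ℕ.+ proj₂ q ≡ suc n →
                    Adjacent (suc n) p (mediant p q)
Adjacent-mediantˡ {n} {a , b} {c , d} (adjacent P Q det) eq =
  adjacent (Proper-suc P) (Proper-mediant P Q eq) (begin
    (a ℕ.+ c) ℕ.* b            ≡⟨ ℕ.*-distribʳ-+ b a c ⟩
    a ℕ.* b ℕ.+ c ℕ.* b        ≡⟨ cong (a ℕ.* b ℕ.+_) det ⟩
    a ℕ.* b ℕ.+ suc (a ℕ.* d)  ≡⟨ ℕ.+-suc (a ℕ.* b) (a ℕ.* d) ⟩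
    suc (a ℕ.* b ℕ.+ a ℕ.* d)  ≡⟨ cong suc (ℕ.*-distribˡ-+ a b d) ⟨
    suc (a ℕ.* (b ℕ.+ d))      ∎)
  where open ≡-Reasoning

Adjacent-mediantʳ : ∀ {n p q} → Adjacent n p q → proj₂ p ℕ.+ proj₂ q ≡ suc n →
                    Adjacent (suc n) (mediant p q) q
Adjacent-mediantʳ {n} {a , b} {c , d} (adjacent P Q det) eq =
  adjacent (Proper-mediant P Q eq) (Proper-suc Q) (begin
    c ℕ.* (b ℕ.+ d)            ≡⟨ ℕ.*-distribˡ-+ c b d ⟩
    c ℕ.* b ℕ.+ c ℕ.* d        ≡⟨ cong (ℕ._+ c ℕ.* d) det ⟩
    suc (a ℕ.* d ℕ.+ c ℕ.* d)  ≡⟨ cong suc (ℕ.*-distribʳ-+ d a c) ⟨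
    suc ((a ℕ.+ c) ℕ.* d)      ∎)
  where open ≡-Reasoning

refine-adjacent : ∀ {n p} qs → Linked (Adjacent n) (p ∷ qs) →
                  Linked (Adjacent (suc n)) (p ∷ refine (suc n) p qs)
refine-adjacent []       _        = [-]
refine-adjacent {n} {p} (q ∷ qs) (pq ∷ l) with proj₂ p ℕ.+ proj₂ q ℕ.≟ suc n
... | yes eq = Adjacent-mediantˡ pq eq ∷ Adjacent-mediantʳ pq eq ∷ refine-adjacent qs l
... | no  _  = Adjacent-suc pq ∷ refine-adjacent qs l

fareyTail-adjacent : ∀ q → Linked (Adjacent (suc q)) ((1 , suc q) ∷ fareyTail q)
fareyTail-adjacent zero    = [-]
fareyTail-adjacent (suc q) =
  adjacent (proper ℕ.≤-refl (ℕ.s≤s ℕ.z≤n) ℕ.≤-refl)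
           (proper ℕ.≤-refl (ℕ.s≤s ℕ.z≤n) (ℕ.n≤1+n _)) refl
  ∷ refine-adjacent (fareyTail q) (fareyTail-adjacent q)

refine-last : ∀ n p qs → last⁺ p (refine n p qs) ≡ last⁺ p qs
refine-last n p []       = refl
refine-last n p (q ∷ qs) with proj₂ p ℕ.+ proj₂ q ℕ.≟ n
... | yes _ = refine-last n q qs
... | no  _ = refine-last n q qs

fareyTail-last : ∀ q → last⁺ (1 , suc q) (fareyTail q) ≡ (1 , 1)
fareyTail-last zero    = refl
fareyTail-last (suc q) = trans (refine-last _ _ (fareyTail q)) (fareyTail-last q)

-- Weights on pairs of adjacent denominators

pairSum : (ℕ → ℕ → ℚ) → Fraction → List Fraction → ℚ
pairSum f p []       = 0ℚ
pairSum f p (q ∷ qs) = f (proj₂ p) (proj₂ q) + pairSum f q qs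

-- Pulls a weight back by one order: a pair with sum `n` is about to receive a mediant, so it is
-- charged in advance with the two pairs that replace it.
split : ℕ → (ℕ → ℕ → ℚ) → ℕ → ℕ → ℚ
split n f x y with x ℕ.+ y ℕ.≟ n
... | yes _ = f x n + f n y
... | no  _ = f x y

split-≡ : ∀ n f {x y} → x ℕ.+ y ≡ n → split n f x y ≡ f x n + f n y
split-≡ n f {x} {y} eq with x ℕ.+ y ℕ.≟ n
... | yes _  = refl
... | no neq = contradiction eq neq

split-≢ : ∀ n f {x y} → x ℕ.+ y ≢ n → split n f x y ≡ f x y
split-≢ n f {x} {y} neq with x ℕ.+ y ℕ.≟ n
... | yes eq = contradiction eq neq
... | no _   = refl

split-nonneg : ∀ n {f} → (∀ x y → 0ℚ ≤ f x y) → ∀ x y → 0ℚ ≤ split n f x y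
split-nonneg n 0≤f x y with x ℕ.+ y ℕ.≟ n
... | yes _ = +-mono-≤ (0≤f x n) (0≤f n y)
... | no  _ = 0≤f x y

pairSum-refine : ∀ n f p qs → pairSum f p (refine n p qs) ≡ pairSum (split n f) p qs
pairSum-refine n f p []       = refl
pairSum-refine n f p (q ∷ qs) with proj₂ p ℕ.+ proj₂ q ℕ.≟ n
... | yes eq = trans (sym (+-assoc (f (proj₂ p) (proj₂ p ℕ.+ proj₂ q)) _ _))
  (cong₂ _+_ (cong (λ m → f (proj₂ p) m + f m (proj₂ q)) eq) (pairSum-refine n f q qs))
... | no  _  = cong (f (proj₂ p) (proj₂ q) +_) (pairSum-refine n f q qs)

-- The sum of f x y over all 1 ≤ x , y ≤ Q with x + y > Q.
triangleSum : ℕ → (ℕ → ℕ → ℚ) → ℚ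
triangleSum Q f = sumBelow Q (λ i → sumBelow (suc i) (λ j → f (suc i) (Q ℕ.∸ j)))

-- In row x = i + 1 only the last entry, y = Q - i, has x + y = Q + 1. Of its two split terms, f x
-- (Q + 1) completes row x of the larger triangle, while f (Q + 1) y goes to the new row Q + 1,
-- which then lacks only its corner.
triangleSum-split : ∀ Q f →
  triangleSum Q (split (suc Q) f) + f (suc Q) (suc Q) ≡ triangleSum (suc Q) f
triangleSum-split Q f = begin
  triangleSum Q (split (suc Q) f) + f (suc Q) (suc Q)
    ≡⟨ cong (_+ f (suc Q) (suc Q)) (trans (sum-cong-< Q row) (sum-add Q _ _)) ⟩
  (rows + sumBelow Q (λ i → f (suc Q) (Q ℕ.∸ i))) + f (suc Q) (suc Q)
    ≡⟨ solve 3 (λ a b c → (a :+ b) :+ c := a :+ (c :+ b)) refl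
         rows (sumBelow Q (λ i → f (suc Q) (Q ℕ.∸ i))) (f (suc Q) (suc Q)) ⟩
  rows + (f (suc Q) (suc Q) + sumBelow Q (λ i → f (suc Q) (Q ℕ.∸ i)))
    ≡⟨ cong (rows +_) (sum-suc Q (λ j → f (suc Q) (suc Q ℕ.∸ j))) ⟨
  triangleSum (suc Q) f ∎
  where
  open ≡-Reasoning
  rows = sumBelow Q (λ i → sumBelow (suc i) (λ j → f (suc i) (suc Q ℕ.∸ j)))
  row : ∀ i → i ℕ.< Q → sumBelow (suc i) (λ j → split (suc Q) f (suc i) (Q ℕ.∸ j))
                      ≡ sumBelow (suc i) (λ j → f (suc i) (suc Q ℕ.∸ j)) + f (suc Q) (Q ℕ.∸ i)
  row i i<Q = begin
    sumBelow i (λ j → split (suc Q) f (suc i) (Q ℕ.∸ j)) + split (suc Q) f (suc i) (Q ℕ.∸ i)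
      ≡⟨ cong₂ _+_
           (sum-cong-< i (λ j j<i → split-≢ (suc Q) f (λ eq → ℕ.<⇒≢ (ℕ.+-monoˡ-< (Q ℕ.∸ j) j<i)
             (trans (ℕ.m+[n∸m]≡n (ℕ.<⇒≤ (ℕ.<-trans j<i i<Q))) (sym (cong ℕ.pred eq))))))
           (split-≡ (suc Q) f (cong suc (ℕ.m+[n∸m]≡n (ℕ.<⇒≤ i<Q)))) ⟩
    sumBelow i (λ j → f (suc i) (Q ℕ.∸ j)) + (f (suc i) (suc Q) + f (suc Q) (Q ℕ.∸ i))
      ≡⟨ solve 3 (λ a b c → a :+ (b :+ c) := (b :+ a) :+ c) refl
           (sumBelow i (λ j → f (suc i) (Q ℕ.∸ j))) (f (suc i) (suc Q)) (f (suc Q) (Q ℕ.∸ i)) ⟩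
    (f (suc i) (suc Q) + sumBelow i (λ j → f (suc i) (Q ℕ.∸ j))) + f (suc Q) (Q ℕ.∸ i)
      ≡⟨ cong (_+ f (suc Q) (Q ℕ.∸ i)) (sum-suc i (λ j → f (suc i) (suc Q ℕ.∸ j))) ⟨
    sumBelow (suc i) (λ j → f (suc i) (suc Q ℕ.∸ j)) + f (suc Q) (Q ℕ.∸ i) ∎

-- Each pair of adjacent denominators occurs at most once.  Induction on the order, for all
-- weights at once: passing to the next order replaces f by split f.
pairSum-fareyTail : ∀ q f → (∀ x y → 0ℚ ≤ f x y) →
  f 1 (suc q) + pairSum f (1 , suc q) (fareyTail q) ≤ triangleSum (suc q) f
pairSum-fareyTail zero    f 0≤f = ≤-reflexive (trans (+-comm (f 1 1) 0ℚ) (sym (+-identityˡ (0ℚ + f 1 1))))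
pairSum-fareyTail (suc q) f 0≤f = begin
  f 1 Q′ + (f Q′ Q + pairSum f (1 , Q) (refine Q′ (1 , Q) (fareyTail q)))
    ≡⟨ +-assoc (f 1 Q′) _ _ ⟨
  (f 1 Q′ + f Q′ Q) + pairSum f (1 , Q) (refine Q′ (1 , Q) (fareyTail q))
    -- The pair (1, Q) has sum `Q′`, so its split weight is exactly that of the new leading pairs
    -- (1, Q′) and (Q′, Q).
    ≡⟨ cong₂ _+_ (sym (split-≡ Q′ f refl)) (pairSum-refine Q′ f (1 , Q) (fareyTail q)) ⟩
  split Q′ f 1 Q + pairSum (split Q′ f) (1 , Q) (fareyTail q)
    ≤⟨ pairSum-fareyTail q (split Q′ f) (split-nonneg Q′ 0≤f) ⟩
  triangleSum Q (split Q′ f)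
    ≤⟨ p≤p+q _ (0≤f Q′ Q′) ⟩
  triangleSum Q (split Q′ f) + f Q′ Q′
    ≡⟨ triangleSum-split Q f ⟩
  triangleSum Q′ f ∎
  where
  open ≤-Reasoning
  Q = suc q
  Q′ = suc Q

-- Bounding the sum over all pairs

-- 1 / y² ≤ 1 / (y - ½) - 1 / (y + ½) for y = n + 1.
⅟-square-≤ : ∀ n → ⅟ (suc n) * ⅟ (suc n) ≤ 2ℚ * (⅟ (suc (2 ℕ.* n)) - ⅟ (suc (2 ℕ.* suc n)))
⅟-square-≤ n = begin
  ⅟ (suc n) * ⅟ (suc n)
    ≡⟨ cong₂ _*_ (⅟-double n) (⅟-double n) ⟩
  (2ℚ * s) * (2ℚ * s)
    ≡⟨ solve 2 (λ t s → (t :* s) :* (t :* s) := t :* (t :* (s :* s))) refl 2ℚ s ⟩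
  2ℚ * (2ℚ * (s * s))
    ≤⟨ *-monoʳ 0≤2 (*-monoʳ 0≤2 ss≤uv) ⟩
  2ℚ * (2ℚ * (u * v))
    ≡⟨ cong (λ d → 2ℚ * (d * (u * v))) (trans (sym diff) (cong₂ _-_ (sym V-eq) (sym U-eq))) ⟩
  2ℚ * ((fromℕ (suc (2 ℕ.* suc n)) - fromℕ (suc (2 ℕ.* n))) * (u * v))
    ≡⟨ cong (2ℚ *_) (recip-difference (fromℕ-pos (2 ℕ.* n)) (fromℕ-pos (2 ℕ.* suc n))) ⟨
  2ℚ * (u - v) ∎
  where
  open ≤-Reasoning
  x = fromℕ n
  s = ⅟ (2 ℕ.* suc n)
  u = ⅟ (suc (2 ℕ.* n))
  v = ⅟ (suc (2 ℕ.* suc n))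
  0≤2 : 0ℚ ≤ 2ℚ
  0≤2 = fromℕ-nonneg 2
  U-eq = fromℕ-1+2* n
  V-eq : fromℕ (suc (2 ℕ.* suc n)) ≡ 2ℚ * (x + 1ℚ) + 1ℚ
  V-eq = trans (fromℕ-1+2* (suc n)) (cong (λ y → 2ℚ * y + 1ℚ) (fromℕ-suc n))
  S-eq : fromℕ (2 ℕ.* suc n) ≡ 2ℚ * (x + 1ℚ)
  S-eq = trans (fromℕ-2* (suc n)) (cong (2ℚ *_) (fromℕ-suc n))
  diff : (2ℚ * (x + 1ℚ) + 1ℚ) - (2ℚ * x + 1ℚ) ≡ 2ℚ
  diff = solve 1 (λ x → (con 2ℚ :* (x :+ con 1ℚ) :+ con 1ℚ) :- (con 2ℚ :* x :+ con 1ℚ) := con 2ℚ) refl x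
  0<S : 0ℚ < fromℕ (2 ℕ.* suc n)
  0<S = fromℕ-pos (n ℕ.+ 1 ℕ.* suc n)
  -- With S = 2 n + 2 this is (S - 1) (S + 1) = S² - 1 ≤ S².
  UV≤SS : fromℕ (suc (2 ℕ.* n)) * fromℕ (suc (2 ℕ.* suc n)) ≤ fromℕ (2 ℕ.* suc n) * fromℕ (2 ℕ.* suc n)
  UV≤SS = 0≤q-p⇒p≤q (subst (0ℚ ≤_) (sym (begin-equality
    fromℕ (2 ℕ.* suc n) * fromℕ (2 ℕ.* suc n) - fromℕ (suc (2 ℕ.* n)) * fromℕ (suc (2 ℕ.* suc n))
      ≡⟨ cong₂ (λ a b → a * a - b) S-eq (cong₂ _*_ U-eq V-eq) ⟩
    (2ℚ * (x + 1ℚ)) * (2ℚ * (x + 1ℚ)) - (2ℚ * x + 1ℚ) * (2ℚ * (x + 1ℚ) + 1ℚ)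
      ≡⟨ solve 1 (λ x → (con 2ℚ :* (x :+ con 1ℚ)) :* (con 2ℚ :* (x :+ con 1ℚ))
                     :- (con 2ℚ :* x :+ con 1ℚ) :* (con 2ℚ :* (x :+ con 1ℚ) :+ con 1ℚ) := con 1ℚ) refl x ⟩
    1ℚ ∎)) 0≤1)
  ss≤uv : s * s ≤ u * v
  ss≤uv = subst₂ _≤_ (recip-* 0<S 0<S) (recip-* (fromℕ-pos (2 ℕ.* n)) (fromℕ-pos (2 ℕ.* suc n)))
    (recip-antitone (*-pos (fromℕ-pos (2 ℕ.* n)) (fromℕ-pos (2 ℕ.* suc n))) UV≤SS)

-- Telescopes `⅟-square-≤` over y from z + 1 to m + z; index 0 carries the largest y, so the
-- induction removes the first summand.
sum-⅟-square : ∀ m z → sumBelow m (λ j → ⅟ (m ℕ.+ z ℕ.∸ j) * ⅟ (m ℕ.+ z ℕ.∸ j))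
                     ≤ 2ℚ * (⅟ (suc (2 ℕ.* z)) - ⅟ (suc (2 ℕ.* (m ℕ.+ z))))
sum-⅟-square zero    z = ≤-reflexive (sym
  (trans (cong (2ℚ *_) (+-inverseʳ (⅟ (suc (2 ℕ.* z))))) (*-zeroʳ 2ℚ)))
sum-⅟-square (suc m) z = begin
  sumBelow (suc m) (λ j → ⅟ (suc m ℕ.+ z ℕ.∸ j) * ⅟ (suc m ℕ.+ z ℕ.∸ j))
    ≡⟨ sum-suc m _ ⟩
  ⅟ (suc (m ℕ.+ z)) * ⅟ (suc (m ℕ.+ z)) + sumBelow m (λ j → ⅟ (m ℕ.+ z ℕ.∸ j) * ⅟ (m ℕ.+ z ℕ.∸ j))
    ≤⟨ +-mono-≤ (⅟-square-≤ (m ℕ.+ z)) (sum-⅟-square m z) ⟩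
  2ℚ * (b - c) + 2ℚ * (a - b)
    ≡⟨ solve 4 (λ t a b c → t :* (b :- c) :+ t :* (a :- b) := t :* (a :- c)) refl 2ℚ a b c ⟩
  2ℚ * (a - c) ∎
  where
  open ≤-Reasoning
  a = ⅟ (suc (2 ℕ.* z))
  b = ⅟ (suc (2 ℕ.* (m ℕ.+ z)))
  c = ⅟ (suc (2 ℕ.* suc (m ℕ.+ z)))

inverseSquare : ℕ → ℕ → ℚ
inverseSquare x y = (⅟ x * ⅟ y) * (⅟ x * ⅟ y)

-- With a = 1 / m, b = 1 / (2 z + 1) and c = 1 / (2 (m + z) + 1), the telescoped row is
-- 2 a² (b - c) = 4 a b c, and a b = (a + 2 b) c.
row-≤ : ∀ m z → let m′ = suc m ; Q = m′ ℕ.+ z in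
  sumBelow m′ (λ j → inverseSquare m′ (Q ℕ.∸ j)) ≤
  (fromℕ 8 * (⅟ (suc (2 ℕ.* Q)) * ⅟ (suc (2 ℕ.* Q)))) * (⅟ (2 ℕ.* m′) + ⅟ (suc (2 ℕ.* z)))
row-≤ m z = begin
  sumBelow m′ (λ j → inverseSquare m′ (Q ℕ.∸ j))
    ≡⟨ sum-cong m′ (λ j → solve 2 (λ a y → (a :* y) :* (a :* y) := (a :* a) :* (y :* y))
                            refl a (⅟ (Q ℕ.∸ j))) ⟩
  sumBelow m′ (λ j → (a * a) * (⅟ (Q ℕ.∸ j) * ⅟ (Q ℕ.∸ j)))
    ≡⟨ sum-*ˡ m′ (a * a) _ ⟩
  (a * a) * sumBelow m′ (λ j → ⅟ (Q ℕ.∸ j) * ⅟ (Q ℕ.∸ j))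
    ≤⟨ *-monoʳ (square-nonneg a) (sum-⅟-square m′ z) ⟩
  (a * a) * (2ℚ * (b - c))
    ≡⟨ cong (λ u → (a * a) * (2ℚ * u)) b-c ⟩
  (a * a) * (2ℚ * ((2ℚ * fromℕ m′) * (b * c)))
    ≡⟨ solve 5 (λ t a b c m → (a :* a) :* (t :* ((t :* m) :* (b :* c)))
         := (t :* t) :* (((m :* a) :* (a :* b)) :* c))
         refl 2ℚ a b c (fromℕ m′) ⟩
  (2ℚ * 2ℚ) * (((fromℕ m′ * a) * (a * b)) * c)
    ≡⟨ cong (λ u → (2ℚ * 2ℚ) * (u * c))
         (trans (cong (_* (a * b)) (⅟-inverse m)) (trans (*-identityˡ (a * b)) ab)) ⟩
  (2ℚ * 2ℚ) * (((a + 2ℚ * b) * c) * c)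
    ≡⟨ cong (λ u → (2ℚ * 2ℚ) * (((u + 2ℚ * b) * c) * c)) (⅟-double m) ⟩
  (2ℚ * 2ℚ) * (((2ℚ * d + 2ℚ * b) * c) * c)
    ≡⟨ solve 4 (λ t b c d → (t :* t) :* (((t :* d :+ t :* b) :* c) :* c)
         := ((t :* t :* t) :* (c :* c)) :* (d :+ b))
         refl 2ℚ b c d ⟩
  (fromℕ 8 * (c * c)) * (d + b) ∎
  where
  open ≤-Reasoning
  m′ = suc m
  Q = m′ ℕ.+ z
  a = ⅟ m′
  b = ⅟ (suc (2 ℕ.* z))
  c = ⅟ (suc (2 ℕ.* Q))
  d = ⅟ (2 ℕ.* m′)
  B = fromℕ (suc (2 ℕ.* z))
  C′ = fromℕ (suc (2 ℕ.* Q))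
  C-eq : C′ ≡ 2ℚ * fromℕ m′ + B
  C-eq = begin-equality
    C′                                      ≡⟨ fromℕ-1+2* Q ⟩
    2ℚ * fromℕ Q + 1ℚ                       ≡⟨ cong (λ u → 2ℚ * u + 1ℚ) (fromℕ-+ m′ z) ⟩
    2ℚ * (fromℕ m′ + fromℕ z) + 1ℚ          ≡⟨ solve 4 (λ t x y o → t :* (x :+ y) :+ o
                                                 := t :* x :+ (t :* y :+ o))
                                                 refl 2ℚ (fromℕ m′) (fromℕ z) 1ℚ ⟩
    2ℚ * fromℕ m′ + (2ℚ * fromℕ z + 1ℚ)     ≡⟨ cong (2ℚ * fromℕ m′ +_) (fromℕ-1+2* z) ⟨
    2ℚ * fromℕ m′ + B                       ∎
  b-c : b - c ≡ (2ℚ * fromℕ m′) * (b * c)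
  b-c = trans (recip-difference (fromℕ-pos (2 ℕ.* z)) (fromℕ-pos (2 ℕ.* Q)))
    (cong (_* (b * c)) (trans (cong (_- B) C-eq) (solve 2 (λ x y → (x :+ y) :- y := x)
                                                    refl (2ℚ * fromℕ m′) B)))
  ab : a * b ≡ (a + 2ℚ * b) * c
  ab = begin-equality
    a * b                                          ≡⟨ *-identityʳ (a * b) ⟨
    (a * b) * 1ℚ                                   ≡⟨ cong ((a * b) *_) (⅟-inverse (2 ℕ.* Q)) ⟨
    (a * b) * (C′ * c)                             ≡⟨ cong (λ u → (a * b) * (u * c)) C-eq ⟩
    (a * b) * ((2ℚ * fromℕ m′ + B) * c)            ≡⟨ solve 6 (λ a b c t m k → (a :* b) :* ((t :* m :+ k) :* c)
                                                        := ((k :* b) :* a :+ t :* ((m :* a) :* b)) :* c)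
                                                        refl a b c 2ℚ (fromℕ m′) B ⟩
    ((B * b) * a + 2ℚ * ((fromℕ m′ * a) * b)) * c  ≡⟨ cong₂ (λ u v → (u * a + 2ℚ * (v * b)) * c)
                                                            (⅟-inverse (2 ℕ.* z)) (⅟-inverse m) ⟩
    (1ℚ * a + 2ℚ * (1ℚ * b)) * c                   ≡⟨ cong₂ (λ u v → (u + 2ℚ * v) * c)
                                                            (*-identityˡ a) (*-identityˡ b) ⟩
    (a + 2ℚ * b) * c                               ∎

harmonic : ℕ → ℚ
harmonic n = sumBelow n (λ i → ⅟ (suc i))

harmonic-double : ∀ n → harmonic (2 ℕ.* n) ≡
  sumBelow n (λ i → ⅟ (2 ℕ.* suc i)) + sumBelow n (λ i → ⅟ (suc (2 ℕ.* i)))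
harmonic-double zero    = refl
harmonic-double (suc n) = begin
  harmonic (2 ℕ.* suc n)
    ≡⟨ cong harmonic (ℕ.*-suc 2 n) ⟩
  (harmonic (2 ℕ.* n) + ⅟ (suc (2 ℕ.* n))) + ⅟ (suc (suc (2 ℕ.* n)))
    ≡⟨ cong₂ (λ u k → (u + ⅟ (suc (2 ℕ.* n))) + ⅟ k) (harmonic-double n) (sym (ℕ.*-suc 2 n)) ⟩
  ((e + o) + ⅟ (suc (2 ℕ.* n))) + ⅟ (2 ℕ.* suc n)
    ≡⟨ solve 4 (λ e o x y → ((e :+ o) :+ x) :+ y := (e :+ y) :+ (o :+ x))
         refl e o (⅟ (suc (2 ℕ.* n))) (⅟ (2 ℕ.* suc n)) ⟩
  (e + ⅟ (2 ℕ.* suc n)) + (o + ⅟ (suc (2 ℕ.* n))) ∎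
  where
  open ≡-Reasoning
  e = sumBelow n (λ i → ⅟ (2 ℕ.* suc i))
  o = sumBelow n (λ i → ⅟ (suc (2 ℕ.* i)))

-- By `row-≤`, row x contributes 1/(2 x) + 1/(2 (Q - x) + 1) up to a common factor. For x from 1 to
-- Q, the first terms run through the even denominators up to 2 Q and the second, in reverse,
-- through the odd ones.
triangleSum-≤ : ∀ Q → triangleSum Q inverseSquare ≤
                (fromℕ 8 * (⅟ (suc (2 ℕ.* Q)) * ⅟ (suc (2 ℕ.* Q)))) * harmonic (2 ℕ.* Q)
triangleSum-≤ Q = begin
  triangleSum Q inverseSquare
    ≤⟨ sum-mono Q (λ i i<Q → subst (λ k → sumBelow (suc i) (λ j → inverseSquare (suc i) (k ℕ.∸ j)) ≤
         (fromℕ 8 * (⅟ (suc (2 ℕ.* k)) * ⅟ (suc (2 ℕ.* k)))) *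
         (⅟ (2 ℕ.* suc i) + ⅟ (suc (2 ℕ.* (Q ℕ.∸ suc i)))))
         (ℕ.m+[n∸m]≡n i<Q) (row-≤ i (Q ℕ.∸ suc i))) ⟩
  sumBelow Q (λ i → k * (⅟ (2 ℕ.* suc i) + ⅟ (suc (2 ℕ.* (Q ℕ.∸ suc i)))))
    ≡⟨ sum-*ˡ Q k _ ⟩
  k * sumBelow Q (λ i → ⅟ (2 ℕ.* suc i) + ⅟ (suc (2 ℕ.* (Q ℕ.∸ suc i))))
    ≡⟨ cong (k *_) (begin-equality
         sumBelow Q (λ i → ⅟ (2 ℕ.* suc i) + ⅟ (suc (2 ℕ.* (Q ℕ.∸ suc i))))
           ≡⟨ sum-add Q _ _ ⟩
         evens + sumBelow Q (λ i → ⅟ (suc (2 ℕ.* (Q ℕ.∸ suc i))))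
           ≡⟨ cong (evens +_) (sum-reverse Q (λ i → ⅟ (suc (2 ℕ.* i)))) ⟩
         evens + sumBelow Q (λ i → ⅟ (suc (2 ℕ.* i)))
           ≡⟨ harmonic-double Q ⟨
         harmonic (2 ℕ.* Q) ∎) ⟩
  k * harmonic (2 ℕ.* Q) ∎
  where
  open ≤-Reasoning
  k = fromℕ 8 * (⅟ (suc (2 ℕ.* Q)) * ⅟ (suc (2 ℕ.* Q)))
  evens = sumBelow Q (λ i → ⅟ (2 ℕ.* suc i))

-- From fractions to the Farey list

value : Fraction → ℚ
value (a , b) = fromℕ a * ⅟ b

-- Since `_/_` reduces to lowest terms, the cancellation is carried out on unnormalised
-- representatives.
/-*-cancel : ∀ a b → (ℤ.+ a / suc b) * fromℕ (suc b) ≡ fromℕ a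
/-*-cancel a b = toℚᵘ-injective (begin
  toℚᵘ ((ℤ.+ a / suc b) * fromℕ (suc b))
    ≈⟨ toℚᵘ-homo-* (ℤ.+ a / suc b) (fromℕ (suc b)) ⟩
  toℚᵘ (ℤ.+ a / suc b) ℚᵘ.* toℚᵘ (fromℕ (suc b))
    ≈⟨ ℚᵘ.*-cong (toℚᵘ-fromℚᵘ (ℚᵘ.mkℚᵘ (ℤ.+ a) b)) (toℚᵘ-fromℚᵘ (ℚᵘ.mkℚᵘ (ℤ.+ suc b) 0)) ⟩
  ℚᵘ.mkℚᵘ (ℤ.+ a) b ℚᵘ.* ℚᵘ.mkℚᵘ (ℤ.+ suc b) 0
    ≈⟨ ℚᵘ.*≡* (ℤ.*-assoc (ℤ.+ a) (ℤ.+ suc b) (ℤ.+ 1)) ⟩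
  ℚᵘ.mkℚᵘ (ℤ.+ a) 0
    ≈⟨ toℚᵘ-fromℚᵘ (ℚᵘ.mkℚᵘ (ℤ.+ a) 0) ⟨
  toℚᵘ (fromℕ a) ∎)
  where open ℚᵘ.≃-Reasoning

/-value : ∀ a b → ℤ.+ a / suc b ≡ value (a , suc b)
/-value a b = begin
  x                                   ≡⟨ *-identityʳ x ⟨
  x * 1ℚ                              ≡⟨ cong (x *_) (⅟-inverse b) ⟨
  x * (fromℕ (suc b) * ⅟ (suc b))     ≡⟨ *-assoc x _ _ ⟨
  (x * fromℕ (suc b)) * ⅟ (suc b)     ≡⟨ cong (_* ⅟ (suc b)) (/-*-cancel a b) ⟩
  fromℕ a * ⅟ (suc b)                 ∎
  where
  open ≡-Reasoning
  x = ℤ.+ a / suc b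

-- A common divisor of c and d divides both c b and a d, hence their difference 1.
determinant⇒gcd≡1 : ∀ {a b c d} → c ℕ.* b ≡ suc (a ℕ.* d) → gcd c d ≡ 1
determinant⇒gcd≡1 {a} {b} {c} {d} det = ∣1⇒≡1 (∣m+n∣m⇒∣n
  (subst (gcd c d ∣_) (trans det (ℕ.+-comm 1 (a ℕ.* d))) (∣-trans (gcd[m,n]∣m c d) (m∣m*n b)))
  (∣-trans (gcd[m,n]∣n c d) (n∣m*n a)))

fractionsOver : ℕ → List ℚ
fractionsOver b = map (λ a → ℤ.+ a / suc b) (numerators (suc b))

coprime? : ∀ b a → Dec (gcd a (suc b) ≡ 1)
coprime? b a = gcd a (suc b) ℕ.≟ 1

value∈fareyFractions : ∀ {n p} → Proper n p → gcd (proj₁ p) (proj₂ p) ≡ 1 → value p ∈ fareyFractions n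
value∈fareyFractions {n} {suc a , suc b} (proper _ a≤b b≤n) coprime =
  subst (_∈ fareyFractions n) (/-value (suc a) b)
    (∈-concatMap⁺ fractionsOver (lose (∈-upTo⁺ b≤n)
      (∈-map⁺ (λ a → ℤ.+ a / suc b)
        (∈-filter⁺ (coprime? b) (∈-map⁺ suc (∈-upTo⁺ a≤b)) coprime))))

fareyFractions-bounds : ∀ {q x} → x ∈ fareyFractions (suc q) → value (1 , suc q) ≤ x × x ≤ 1ℚ
fareyFractions-bounds {q} x∈
  with b , b∈ , x∈′ ← find (∈-concatMap⁻ fractionsOver {xs = upTo (suc q)} x∈)
  with _ , a∈ , refl ← ∈-map⁻ (λ a → ℤ.+ a / suc b) x∈′
  with i , i∈ , refl ← ∈-map⁻ suc (proj₁ (∈-filter⁻ (coprime? b) {xs = map suc (upTo (suc b))} a∈)) =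
  subst (λ x → value (1 , suc q) ≤ x × x ≤ 1ℚ) (sym (/-value (suc i) b))
    ( *-mono (⅟-nonneg q) (fromℕ-nonneg (suc i)) (fromℕ-mono-≤ {1} {suc i} (ℕ.s≤s ℕ.z≤n))
             (recip-antitone (fromℕ-pos b) (fromℕ-mono-≤ (∈-upTo⁻ b∈)))
    , subst (fromℕ (suc i) * ⅟ (suc b) ≤_) (⅟-inverse b)
            (*-monoˡ (⅟-nonneg b) (fromℕ-mono-≤ (∈-upTo⁻ i∈))))

adjacent-gap : ∀ {n p q} → Adjacent n p q → value q - value p ≡ ⅟ (proj₂ p) * ⅟ (proj₂ q)
adjacent-gap {n} {a , zero}  {c , d}     (adjacent (proper 0<a a≤0 _) _ _) =
  contradiction (ℕ.<-≤-trans 0<a a≤0) λ ()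
adjacent-gap {n} {a , suc b} {c , zero}  (adjacent _ (proper 0<c c≤0 _) _) =
  contradiction (ℕ.<-≤-trans 0<c c≤0) λ ()
adjacent-gap {n} {a , suc b} {c , suc d} (adjacent _ _ det) = begin
  γ * t - α * s
    ≡⟨ cong₂ _-_ (*-identityˡ (γ * t)) (*-identityˡ (α * s)) ⟨
  1ℚ * (γ * t) - 1ℚ * (α * s)
    ≡⟨ cong₂ (λ u v → u * (γ * t) - v * (α * s)) (⅟-inverse b) (⅟-inverse d) ⟨
  (β * s) * (γ * t) - (δ * t) * (α * s)
    ≡⟨ solve 6 (λ a b c d s t → (b :* s) :* (c :* t) :- (d :* t) :* (a :* s) := (c :* b :- a :* d) :* (s :* t))
         refl α β γ δ s t ⟩
  (γ * β - α * δ) * (s * t)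
    ≡⟨ cong (λ u → (u - α * δ) * (s * t)) (begin
         γ * β                              ≡⟨ fromℕ-* c (suc b) ⟨
         fromℕ (c ℕ.* suc b)                ≡⟨ cong fromℕ det ⟩
         fromℕ (suc (a ℕ.* suc d))          ≡⟨ fromℕ-suc (a ℕ.* suc d) ⟩
         fromℕ (a ℕ.* suc d) + 1ℚ           ≡⟨ cong (_+ 1ℚ) (fromℕ-* a (suc d)) ⟩
         α * δ + 1ℚ                         ∎) ⟩
  ((α * δ + 1ℚ) - α * δ) * (s * t)
    ≡⟨ solve 2 (λ u v → ((u :+ con 1ℚ) :- u) :* v := v) refl (α * δ) (s * t) ⟩
  s * t ∎
  where
  open ≡-Reasoning
  α = fromℕ a
  β = fromℕ (suc b)
  γ = fromℕ c
  δ = fromℕ (suc d)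
  s = ⅟ (suc b)
  t = ⅟ (suc d)

0<denominator : ∀ {n p} → Proper n p → 0 ℕ.< proj₂ p
0<denominator P = ℕ.<-≤-trans (0<numerator P) (num≤den P)

adjacent-< : ∀ {n p q} → Adjacent n p q → value p < value q
adjacent-< pq = 0<q-p⇒p<q (subst (0ℚ <_) (sym (adjacent-gap pq))
  (*-pos (⅟-pos′ (0<denominator (properˡ pq))) (⅟-pos′ (0<denominator (properʳ pq)))))

sumSquaredGaps-adjacent : ∀ {n p} qs → Linked (Adjacent n) (p ∷ qs) →
  sumSquaredGaps (map value (p ∷ qs)) ≡ pairSum inverseSquare p qs
sumSquaredGaps-adjacent []       _        = refl
sumSquaredGaps-adjacent (q ∷ qs) (pq ∷ l) =
  cong₂ _+_ (cong (λ d → d * d) (adjacent-gap pq)) (sumSquaredGaps-adjacent qs l)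

adjacent⇒∈ : ∀ {n p} qs → Linked (Adjacent n) (p ∷ qs) → All (λ q → value q ∈ fareyFractions n) qs
adjacent⇒∈ []       _        = []
adjacent⇒∈ {p = a , b} (q ∷ qs) (pq ∷ l) =
  value∈fareyFractions (properʳ pq) (determinant⇒gcd≡1 {a} {b} {proj₁ q} {proj₂ q} (determinant pq))
  ∷ adjacent⇒∈ qs l

-- The mediant fractions lie in the Farey list and share its extremes 1 / Q and 1, so the Farey list
-- refines them.
S₂-≤-pairSum : ∀ q → S₂ (suc q) ≤ pairSum inverseSquare (1 , suc q) (fareyTail q)
S₂-≤-pairSum q = begin
  sumSquaredGaps (farey (suc q))
    -- A further copy of 1 / Q in front gives both lists the common starting point that
    -- `sumSquaredGaps-refine` asks for.
    ≤⟨ sumSquaredGaps-∷ (value p) (farey (suc q)) ⟩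
  sumSquaredGaps (value p ∷ farey (suc q))
    ≤⟨ sumSquaredGaps-refine (farey (suc q)) (map value (fareyTail q))
         (All.tabulate (λ x∈ → proj₁ (bounds x∈)))
         (Sorted⇒AllPairs (DecTotalOrder.totalOrder ≤-decTotalOrder) (sort-↗ (fareyFractions (suc q))))
         (AllPairs.tail (Linked.Linked⇒AllPairs <-trans (Linked.map⁺ (Linked.map adjacent-< l))))
         (All.map⁺ (All.map (∈-resp-↭ (↭-sym (sort-↭ (fareyFractions (suc q)))))
           (adjacent⇒∈ (fareyTail q) l)))
         (All.tabulate (λ {x} x∈ → subst (x ≤_)
           (sym (trans (last⁺-map value p (fareyTail q)) (cong value (fareyTail-last q))))
           (proj₂ (bounds x∈)))) ⟩
  sumSquaredGaps (map value (p ∷ fareyTail q))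
    ≡⟨ sumSquaredGaps-adjacent (fareyTail q) l ⟩
  pairSum inverseSquare p (fareyTail q) ∎
  where
  open ≤-Reasoning
  p = (1 , suc q)
  l = fareyTail-adjacent q
  bounds : ∀ {x} → x ∈ farey (suc q) → value p ≤ x × x ≤ 1ℚ
  bounds x∈ = fareyFractions-bounds {q} (∈-resp-↭ (sort-↭ (fareyFractions (suc q))) x∈)

-- Comparison with the logarithm

3/2 : ℚ
3/2 = ℤ.+ 3 / 2

7/2 : ℚ
7/2 = ℤ.+ 7 / 2

harmonic-bound : ℕ → ℚ
harmonic-bound Q =
  (fromℕ 8 * ((fromℕ Q * ⅟ (suc (2 ℕ.* Q))) * (fromℕ Q * ⅟ (suc (2 ℕ.* Q))))) * harmonic (2 ℕ.* Q) - 1ℚ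

S₂-≤-harmonic : ∀ q → S₂ (suc q) * fromℕ (suc q ℕ.^ 2) ≤ harmonic-bound (suc q)
S₂-≤-harmonic q = begin
  S₂ Q * fromℕ (Q ℕ.^ 2)
    ≡⟨ cong (S₂ Q *_) (trans (cong (λ k → fromℕ (Q ℕ.* k)) (ℕ.*-identityʳ Q)) (fromℕ-* Q Q)) ⟩
  S₂ Q * (X * X)
    ≤⟨ *-monoˡ (square-nonneg X) (≤-trans (S₂-≤-pairSum q) pairSum≤) ⟩
  ((fromℕ 8 * (c * c)) * H - inverseSquare 1 Q) * (X * X)
    ≡⟨ solve 6 (λ e c h w x a → ((e :* (c :* c)) :* h :- (w :* a) :* (w :* a)) :* (x :* x)
         := (e :* ((x :* c) :* (x :* c))) :* h :- (w :* (x :* a)) :* (w :* (x :* a)))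
         refl (fromℕ 8) c H (⅟ 1) X (⅟ Q) ⟩
  (fromℕ 8 * ((X * c) * (X * c))) * H - (⅟ 1 * (X * ⅟ Q)) * (⅟ 1 * (X * ⅟ Q))
    ≡⟨ cong (λ u → (fromℕ 8 * ((X * c) * (X * c))) * H - (⅟ 1 * u) * (⅟ 1 * u)) (⅟-inverse q) ⟩
  (fromℕ 8 * ((X * c) * (X * c))) * H - 1ℚ ∎
  where
  open ≤-Reasoning
  Q = suc q
  X = fromℕ Q
  c = ⅟ (suc (2 ℕ.* Q))
  H = harmonic (2 ℕ.* Q)
  P = pairSum inverseSquare (1 , Q) (fareyTail q)
  -- The triangle also contains the pair (1, Q), which is no gap of the list; its weight 1 / Q²
  -- becomes the subtracted 1 after multiplication by Q².
  pairSum≤ : P ≤ (fromℕ 8 * (c * c)) * H - inverseSquare 1 Q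
  pairSum≤ = subst (_≤ (fromℕ 8 * (c * c)) * H - inverseSquare 1 Q)
    (solve 2 (λ a b → (a :+ b) :- a := b) refl (inverseSquare 1 Q) P)
    (+-monoˡ-≤ (- inverseSquare 1 Q)
      (≤-trans (pairSum-fareyTail q inverseSquare (λ x y → square-nonneg (⅟ x * ⅟ y))) (triangleSum-≤ Q)))

harmonic-mono : ∀ {m n} → m ℕ.≤ n → harmonic m ≤ harmonic n
harmonic-mono {m} {n} m≤n = begin
  harmonic m                                                     ≤⟨ p≤p+q _ (sum-nonneg (n ℕ.∸ m)) ⟩
  harmonic m + sumBelow (n ℕ.∸ m) (λ j → ⅟ (suc (m ℕ.+ j)))      ≡⟨ sum-+ m (n ℕ.∸ m) (λ i → ⅟ (suc i)) ⟨
  harmonic (m ℕ.+ (n ℕ.∸ m))                                     ≡⟨ cong harmonic (ℕ.m+[n∸m]≡n m≤n) ⟩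
  harmonic n                                                     ∎
  where
  open ≤-Reasoning
  sum-nonneg : ∀ k → 0ℚ ≤ sumBelow k (λ j → ⅟ (suc (m ℕ.+ j)))
  sum-nonneg zero    = ≤-refl
  sum-nonneg (suc k) = +-mono-≤ (sum-nonneg k) (⅟-nonneg (m ℕ.+ k))

-- From Q = 10 on, the bounds 4 (Q / (2 Q + 1))² ≤ 1 and H(2 Q) > 7/2 suffice.
harmonic-bound-< : ∀ k → let Q = suc (suc k) in
  harmonic-bound Q < fromℕ 3 * (harmonic (2 ℕ.* Q) - 3/2)
harmonic-bound-< 0 = from-yes (harmonic-bound 2 <? fromℕ 3 * (harmonic 4 - 3/2))
harmonic-bound-< 1 = from-yes (harmonic-bound 3 <? fromℕ 3 * (harmonic 6 - 3/2))
harmonic-bound-< 2 = from-yes (harmonic-bound 4 <? fromℕ 3 * (harmonic 8 - 3/2))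
harmonic-bound-< 3 = from-yes (harmonic-bound 5 <? fromℕ 3 * (harmonic 10 - 3/2))
harmonic-bound-< 4 = from-yes (harmonic-bound 6 <? fromℕ 3 * (harmonic 12 - 3/2))
harmonic-bound-< 5 = from-yes (harmonic-bound 7 <? fromℕ 3 * (harmonic 14 - 3/2))
harmonic-bound-< 6 = from-yes (harmonic-bound 8 <? fromℕ 3 * (harmonic 16 - 3/2))
harmonic-bound-< 7 = from-yes (harmonic-bound 9 <? fromℕ 3 * (harmonic 18 - 3/2))
harmonic-bound-< (suc (suc (suc (suc (suc (suc (suc (suc k)))))))) = begin-strict
  (fromℕ 8 * (t * t)) * H - 1ℚ
    ≤⟨ +-monoˡ-≤ (- 1ℚ) (*-monoˡ 0≤H (*-monoʳ (fromℕ-nonneg 8) (*-mono 0≤t (nonNegative⁻¹ ½) t≤½ t≤½))) ⟩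
  2ℚ * H - 1ℚ
    -- 2 H - 1 < 3 (H - 3/2) amounts to H > 7/2, and Q = 10 is the first order with H(2 Q) > 7/2.
    ≡⟨ solve 1 (λ h → con 2ℚ :* h :- con 1ℚ := (con 2ℚ :* h :- con (fromℕ 3 * 3/2)) :+ con 7/2) refl H ⟩
  (2ℚ * H - fromℕ 3 * 3/2) + 7/2
    <⟨ +-monoʳ-< (2ℚ * H - fromℕ 3 * 3/2)
         (<-≤-trans (from-yes (7/2 <? harmonic 20)) (harmonic-mono (ℕ.*-monoʳ-≤ 2 {10} (ℕ.m≤m+n 10 k)))) ⟩
  (2ℚ * H - fromℕ 3 * 3/2) + H
    ≡⟨ solve 1 (λ h → (con 2ℚ :* h :- con (fromℕ 3 * 3/2)) :+ h := con (fromℕ 3) :* (h :- con 3/2)) refl H ⟩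
  fromℕ 3 * (H - 3/2) ∎
  where
  open ≤-Reasoning
  Q = 10 ℕ.+ k
  H = harmonic (2 ℕ.* Q)
  c = ⅟ (suc (2 ℕ.* Q))
  t = fromℕ Q * c
  0≤c : 0ℚ ≤ c
  0≤c = ⅟-nonneg (2 ℕ.* Q)
  0≤t : 0ℚ ≤ t
  0≤t = *-nonneg (fromℕ-nonneg Q) 0≤c
  0≤H : 0ℚ ≤ H
  0≤H = harmonic-mono {0} {2 ℕ.* Q} ℕ.z≤n
  t≤½ : t ≤ ½
  t≤½ = begin
    t                                      ≡⟨ solve 2 (λ x c → x :* c := con ½ :* ((con 2ℚ :* x) :* c))
                                                refl (fromℕ Q) c ⟩
    ½ * ((2ℚ * fromℕ Q) * c)               ≡⟨ cong (λ u → ½ * (u * c)) (fromℕ-2* Q) ⟨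
    ½ * (fromℕ (2 ℕ.* Q) * c)              ≤⟨ *-monoʳ (nonNegative⁻¹ ½)
                                                (*-monoˡ 0≤c (fromℕ-mono-≤ (ℕ.n≤1+n (2 ℕ.* Q)))) ⟩
    ½ * (fromℕ (suc (2 ℕ.* Q)) * c)        ≡⟨ cong (½ *_) (⅟-inverse (2 ℕ.* Q)) ⟩
    ½                                      ∎

-- The 2 (Q - 1) subintervals of [1, Q] have length ½.
lowerSum-harmonic : ∀ k (0<x : 0ℚ < fromℕ (suc (suc k))) →
  LogSums.lowerSum 0<x (2 ℕ.* suc k) ≡ harmonic (2 ℕ.* suc (suc k)) - 3/2
lowerSum-harmonic k 0<x = begin
  sumBelow n (λ i → s * ((x - 1ℚ) * recip (1ℚ + (fromℕ (suc i) * s) * (x - 1ℚ))))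
    ≡⟨ sum-cong n term ⟩
  sumBelow n (λ i → ⅟ (suc (2 ℕ.+ i)))
    -- The terms are 1/3, ..., 1/(2 Q); the missing 1 + 1/2 is `harmonic 2`, which evaluates to
    -- `3/2`.
    ≡⟨ solve 2 (λ a b → a := (b :+ a) :- b) refl
         (sumBelow n (λ i → ⅟ (suc (2 ℕ.+ i)))) 3/2 ⟩
  (harmonic 2 + sumBelow n (λ i → ⅟ (suc (2 ℕ.+ i)))) - 3/2
    ≡⟨ cong (_- 3/2) (sum-+ 2 n (λ i → ⅟ (suc i))) ⟨
  harmonic (2 ℕ.+ n) - 3/2
    ≡⟨ cong (λ m → harmonic m - 3/2) (ℕ.*-suc 2 (suc k)) ⟨
  harmonic (2 ℕ.* suc (suc k)) - 3/2 ∎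
  where
  open ≡-Reasoning
  n = 2 ℕ.* suc k
  s = ⅟ n
  x = fromℕ (suc (suc k))
  s*c≡½ : s * (x - 1ℚ) ≡ ½
  s*c≡½ = begin
    s * (x - 1ℚ)                    ≡⟨ cong (λ u → s * (u - 1ℚ)) (fromℕ-suc (suc k)) ⟩
    s * ((fromℕ (suc k) + 1ℚ) - 1ℚ) ≡⟨ solve 2 (λ s y → s :* ((y :+ con 1ℚ) :- con 1ℚ)
                                         := con ½ :* ((con 2ℚ :* y) :* s))
                                         refl s (fromℕ (suc k)) ⟩
    ½ * ((2ℚ * fromℕ (suc k)) * s)  ≡⟨ cong (λ u → ½ * (u * s)) (fromℕ-2* (suc k)) ⟨
    ½ * (fromℕ n * s)               ≡⟨ cong (½ *_) (⅟-inverse (k ℕ.+ 1 ℕ.* suc k)) ⟩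
    ½                               ∎
  term : ∀ i → s * ((x - 1ℚ) * recip (1ℚ + (fromℕ (suc i) * s) * (x - 1ℚ))) ≡ ⅟ (suc (2 ℕ.+ i))
  term i = begin
    s * ((x - 1ℚ) * recip (1ℚ + (fromℕ (suc i) * s) * (x - 1ℚ)))
      ≡⟨ *-assoc s (x - 1ℚ) _ ⟨
    (s * (x - 1ℚ)) * recip (1ℚ + (fromℕ (suc i) * s) * (x - 1ℚ))
      ≡⟨ cong (λ u → (s * (x - 1ℚ)) * recip (1ℚ + u)) (*-assoc (fromℕ (suc i)) s (x - 1ℚ)) ⟩
    (s * (x - 1ℚ)) * recip (1ℚ + fromℕ (suc i) * (s * (x - 1ℚ)))
      ≡⟨ cong (λ u → u * recip (1ℚ + fromℕ (suc i) * u)) s*c≡½ ⟩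
    ½ * recip (1ℚ + fromℕ (suc i) * ½)
      ≡⟨ cong (λ u → ½ * recip u) (solve 1 (λ y → con 1ℚ :+ y :* con ½ := con ½ :* (con 2ℚ :+ y))
                                     refl (fromℕ (suc i))) ⟩
    ½ * recip (½ * (2ℚ + fromℕ (suc i)))
      ≡⟨ cong (λ u → ½ * recip (½ * u)) (trans (sym (fromℕ-+ 2 (suc i))) (cong fromℕ (ℕ.+-suc 2 i))) ⟩
    ½ * recip (½ * fromℕ (suc (2 ℕ.+ i)))
      ≡⟨ cong (½ *_) (recip-* (positive⁻¹ ½) (fromℕ-pos (2 ℕ.+ i))) ⟩
    ½ * (recip ½ * ⅟ (suc (2 ℕ.+ i)))
      ≡⟨ *-assoc ½ (recip ½) (⅟ (suc (2 ℕ.+ i))) ⟨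
    1ℚ * ⅟ (suc (2 ℕ.+ i))
      ≡⟨ *-identityˡ _ ⟩
    ⅟ (suc (2 ℕ.+ i)) ∎

-- Passage to the limit in the real quotient

-- Cutting each subinterval into N + 1 parts does not decrease the lower sum and leads to the term
-- of `log` at an index M ≥ N. The Cauchy property compares that term with every later one at the
-- cost of `η`.
log-≥-lowerSum : ∀ {x} (0<x : 0ℚ < x) m {η} → 0ℚ < η →
  ∃[ N ] (∀ n → N ℕ.≤ n → LogSums.lowerSum 0<x (suc m) - η ≤ seq (log x 0<x) n)
log-≥-lowerSum {x} 0<x m {η} 0<η = N , λ n N≤n → begin
  LogSums.lowerSum 0<x (suc m) - η
    ≤⟨ +-monoˡ-≤ (- η) (LogSums.lowerSum-refine 0<x m N) ⟩
  LogSums.lowerSum 0<x (suc M) - η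
    ≡⟨ cong (_- η) (riemannSum≡lowerSum 0<x (suc M)) ⟨
  l M - η
    ≡⟨ solve 3 (λ a b h → a :- h := b :+ ((a :- b) :- h)) refl (l M) (l n) η ⟩
  l n + ((l M - l n) - η)
    ≤⟨ +-monoʳ-≤ (l n) (≤-trans
         (+-monoˡ-≤ (- η) (≤-trans (p≤∣p∣ (l M - l n)) (close M n (ℕ.m≤m+n N (m ℕ.* suc N)) N≤n)))
         (≤-reflexive (+-inverseʳ η))) ⟩
  l n + 0ℚ
    ≡⟨ +-identityʳ (l n) ⟩
  l n ∎
  where
  open ≤-Reasoning
  l = seq (log x 0<x)
  N = proj₁ (cauchy (log x 0<x) η 0<η)
  close = proj₂ (cauchy (log x 0<x) η 0<η)
  M = N ℕ.+ m ℕ.* suc N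

-- Half of the slack δ = b c - a pays for the approximation: y ≥ c - δ/(2 b) gives b y ≥ a + δ/2.
-- Dividing by y, with y ≤ U, leaves a/y + δ/(2 U) ≤ b, so the other half yields the uniform margin
-- of a strict real inequality.
/ℝ-< : ∀ {a b c} y (0<y : 0ℝ <ℝ y) → 0ℚ < b → a < b * c →
       (∀ {η} → 0ℚ < η → ∃[ N ] (∀ n → N ℕ.≤ n → c - η ≤ seq y n)) →
       fromℚ a /ℝ y [ 0<y ] <ℝ fromℚ b
/ℝ-< {a} {b} {c} y (ε , 0<ε , N₁ , ε≤) 0<b a<bc approx =
  (½ * δ) * recip U , *-pos 0<½δ (recip-pos 0<U) , N₁ ℕ.⊔ (N₂ ℕ.⊔ N₃) , λ n N≤n →
  bound n (ℕ.m⊔n≤o⇒m≤o N₁ (N₂ ℕ.⊔ N₃) N≤n)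
          (ℕ.m⊔n≤o⇒m≤o N₂ N₃ (ℕ.m⊔n≤o⇒n≤o N₁ (N₂ ℕ.⊔ N₃) N≤n))
          (ℕ.m⊔n≤o⇒n≤o N₂ N₃ (ℕ.m⊔n≤o⇒n≤o N₁ (N₂ ℕ.⊔ N₃) N≤n))
  where
  open ≤-Reasoning
  U = proj₁ (bounded y)
  0<U = proj₁ (proj₂ (bounded y))
  N₂ = proj₁ (proj₂ (proj₂ (bounded y)))
  ∣y∣≤U = proj₂ (proj₂ (proj₂ (bounded y)))
  δ = b * c - a
  0<½δ : 0ℚ < ½ * δ
  0<½δ = *-pos (positive⁻¹ ½) (p<q⇒0<q-p a<bc)
  η = ½ * δ * recip b
  0<η : 0ℚ < η
  0<η = *-pos 0<½δ (recip-pos 0<b)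
  N₃ = proj₁ (approx 0<η)
  bη≡½δ : b * η ≡ ½ * δ
  bη≡½δ = begin-equality
    b * (½ * δ * recip b)    ≡⟨ solve 3 (λ b h s → b :* (h :* s) := h :* (b :* s))
                                  refl b (½ * δ) (recip b) ⟩
    ½ * δ * (b * recip b)    ≡⟨ cong (½ * δ *_) (recip-inverse 0<b) ⟩
    ½ * δ * 1ℚ               ≡⟨ *-identityʳ (½ * δ) ⟩
    ½ * δ                    ∎
  a+½δ≤ : ∀ n → N₃ ℕ.≤ n → a + ½ * δ ≤ b * seq y n
  a+½δ≤ n N₃≤n = begin
    a + ½ * δ
      ≡⟨ solve 3 (λ a b c → a :+ con ½ :* (b :* c :- a) := b :* c :- con ½ :* (b :* c :- a)) refl a b c ⟩
    b * c - ½ * δ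
      ≡⟨ cong (λ u → b * c - u) bη≡½δ ⟨
    b * c - b * η
      ≡⟨ solve 3 (λ b c h → b :* c :- b :* h := b :* (c :- h)) refl b c η ⟩
    b * (c - η)
      ≤⟨ *-monoʳ (<⇒≤ 0<b) (proj₂ (approx 0<η) n N₃≤n) ⟩
    b * seq y n ∎
  bound : ∀ n → N₁ ℕ.≤ n → N₂ ℕ.≤ n → N₃ ℕ.≤ n → a * recip (seq y n) + (½ * δ) * recip U ≤ b
  bound n N₁≤n N₂≤n N₃≤n = begin
    a * s + (½ * δ) * recip U     ≤⟨ +-monoʳ-≤ (a * s) (*-monoʳ (<⇒≤ 0<½δ) (recip-antitone 0<yₙ yₙ≤U)) ⟩
    a * s + (½ * δ) * s           ≡⟨ *-distribʳ-+ s a (½ * δ) ⟨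
    (a + ½ * δ) * s               ≤⟨ *-monoˡ (<⇒≤ (recip-pos 0<yₙ)) (a+½δ≤ n N₃≤n) ⟩
    (b * seq y n) * s             ≡⟨ *-assoc b (seq y n) s ⟩
    b * (seq y n * s)             ≡⟨ cong (b *_) (recip-inverse 0<yₙ) ⟩
    b * 1ℚ                        ≡⟨ *-identityʳ b ⟩
    b                             ∎
    where
    s = recip (seq y n)
    0<yₙ : 0ℚ < seq y n
    0<yₙ = <-≤-trans 0<ε (subst (_≤ seq y n) (+-identityˡ ε) (ε≤ n N₁≤n))
    yₙ≤U : seq y n ≤ U
    yₙ≤U = ≤-trans (p≤∣p∣ (seq y n)) (∣y∣≤U n N₂≤n)

theorem1 : ∀ (Q : ℕ) (1<Q : 1 ℕ.< Q) → C Q 1<Q <ℝ fromℚ (fromℕ 3)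
theorem1 (suc zero)      (ℕ.s≤s ())
theorem1 Q@(suc (suc k)) 1<Q =
  /ℝ-< {c = LogSums.lowerSum 0<Q (2 ℕ.* suc k)}
  (log (fromℕ Q) 0<Q) (log-pos 0<Q (fromℕ-mono-< 1<Q)) (fromℕ-pos 2)
  (≤-<-trans (S₂-≤-harmonic (suc k))
    (subst (λ L → harmonic-bound Q < fromℕ 3 * L) (sym (lowerSum-harmonic k 0<Q)) (harmonic-bound-< k)))
  -- The successor of this index computes to `2 ℕ.* suc k`, the number of half-unit subintervals of
  -- [1, Q].
  (log-≥-lowerSum 0<Q (k ℕ.+ 1 ℕ.* suc k))
  where
  0<Q = 0<fromℕ 1<Q
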